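{- Let $n\ge 2$. To each line of play of Planted Brussels Sprouts of order $n$ associate a sequence of transpositions $(t_1,\dots,t_{n-1})$ in the symmetric group $S_n$ as follows. Suppose the $k$-th move joins free arms with short labels $i$ and $j$. Let $i'$ and $j'$ be the short labels of the free arms immediately counterclockwise from the arm $i$ and from the arm $j$, respectively, within the region in which the move is made. Set $t_k=(i'\ j')$. Then the following hold: (1) $t_{n-1}t_{n-2}\cdots t_1=(1\,2\,\cdots\,n)$, where permutations are composed from right to left, so $t_1$ is applied first; (2) distinct lines of play give distinct sequences; (3) every sequence of $n-1$ transpositions $(t_1,\dots,t_{n-1})$ with $t_{n-1}\cdots t_1=(1\,2\,\cdots\,n)$ arises from some line of play. Hence these sequences are exactly the $n^{n-2}$ factorizations of the cycle $(1\,2\,\cdots\,n)$ into $n-1$ transpositions.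
   Context: Planted Brussels Sprouts of order $n$: start with a closed disk with $n$ marked points on its boundary circle, labeled $1,\dots,n$ in clockwise order. Attached to each marked point is an arm, a short segment pointing into the interior of the disk; these arms are free. A move consists of two steps. First, choose two free arms and join their free ends by a simple curve (an arc) in the disk that does not intersect any previously drawn arc or arm; the two joined arms cease to be free. Second, mark a point (a notch) on the arc, from which two new free arms emanate, one on each side of the arc. The game ends when no move is possible. A line of play is the full sequence of moves. Two lines of play are the same iff for each $k$ the arms joined at the $k$-th move coincide. Arms are identified by long labels: the original arm $i$ has long label $i$, and when arms with long labels $\alpha,\beta$ are joined, the new arms have long labels $(\alpha,\beta)$ and $(\beta,\alpha)$. Short labels: the original arm at point $i$ has short label $i$. If an arc joins arms with short labels $i$ and $j$, the two new arms receive short labels $i$ and $j$, placed so that, going clockwise around the notch, one sees the old arm $i$, the new arm $i$, the old arm $j$, and the new arm $j$. Regions and subgames: at any stage, the drawn arcs divide the disk into regions. The free arms in a region form a subgame, and any move joins two free arms of the same region. Within a region, the free arms carry distinct short labels and have a cyclic (clockwise) order around the region. "Immediately counterclockwise" refers to the preceding free arm in this cyclic order. For example, the first move joining original arms $i$ and $j$ yields $t_1=(i-1\ \ j-1)$, with indices taken mod $n$ in $\{1,\dots,n\}$. -}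

module Defs where

open import Data.Nat using (ℕ; suc; _∸_)
open import Data.Nat.DivMod using (_mod_)
open import Data.Fin using (Fin; toℕ)
open import Data.Fin.Properties using (nonZeroIndex)
open import Data.Fin.Permutation as Perm using (Permutation′; transpose; _∘ₚ_; _⟨$⟩ʳ_)
open import Data.List using (List; []; _∷_; _++_; [_]; map; allFin; foldr; length)
open import Data.List.Membership.Propositional using (_∈_)
open import Data.List.Relation.Unary.All using (All)
open import Data.List.Relation.Unary.Any using (_─_)
open import Data.List.Relation.Binary.Pointwise using (Pointwise)
import Data.List.Relation.Binary.Pointwise as Pointwise
open import Data.Product using (Σ; ∃₂; _×_; _,_; proj₁)
open import Data.Sum using (_⊎_)
open import Level using (0ℓ)
open import Relation.Binary.Bundles using (Setoid)
import Relation.Binary.Construct.On as On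
open import Relation.Binary.PropositionalEquality using (_≡_; _≢_; _≗_; refl; sym; trans)
open import Relation.Nullary using (¬_)

private
  variable
    n : ℕ

------------------------------------------------------------------------
-- Positions

-- Arms are identified by their long labels.  The marked point i + 1 of the
-- disk is represented by i : Fin n.
data Arm (n : ℕ) : Set where
  orig  : Fin n → Arm n
  ⟨_,_⟩ : Arm n → Arm n → Arm n

-- Clockwise around the notch on the arc joining α and β one sees
-- α , ⟨ α , β ⟩ , β , ⟨ β , α ⟩; hence ⟨ α , β ⟩ is the new arm that
-- inherits the short label of α.
short : Arm n → Fin n
short (orig i)  = i
short ⟨ α , β ⟩ = short α

-- The free arms of a region, in clockwise order.  The order is cyclic: the
-- arm at which the list starts is immaterial, see _↻_.
Region : ℕ → Set
Region n = List (Arm n)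

-- The regions into which the drawn arcs divide the disk; their order in the
-- list is immaterial.
Position : ℕ → Set
Position n = List (Region n)

start : ∀ n → Position n
start n = [ map orig (allFin n) ]

-- r ↻ s : the lists r and s are the same up to cyclic rotation.
_↻_ : Region n → Region n → Set
r ↻ s = ∃₂ λ us vs → r ≡ us ++ vs × s ≡ vs ++ us

-- The last element of x ∷ xs.
lastOf : {A : Set} → A → List A → A
lastOf x []       = x
lastOf x (y ∷ ys) = lastOf y ys

------------------------------------------------------------------------
-- Moves

-- Joining two free arms α and β of one region.  Read clockwise from α, the
-- region is α, ys, β, zs.  The pair {α , β} is unordered: exchanging α and β
-- (and ys and zs) describes the same move.
record Move (P : Position n) : Set where
  field
    {region} : Region n
    region∈P : region ∈ P
    α β      : Arm n
    ys zs    : List (Arm n)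
    clockwise : region ↻ (α ∷ ys ++ β ∷ zs)

  -- The arc separates ys from zs.  Leaving α clockwise one meets ys, and
  -- leaving the old arm α clockwise around the notch one meets ⟨ α , β ⟩; so
  -- this new arm lies on the side of ys, where it takes the place of α in the
  -- clockwise order.  Likewise for ⟨ β , α ⟩ and zs.
  result : Position n
  result = (⟨ α , β ⟩ ∷ ys) ∷ (⟨ β , α ⟩ ∷ zs) ∷ (P ─ region∈P)

  joined : Arm n × Arm n
  joined = α , β

  -- In the cyclic order α, ys, β, zs the arm immediately counterclockwise
  -- from α is the last one of β ∷ zs, and the one immediately
  -- counterclockwise from β is the last one of α ∷ ys.
  ccwα ccwβ : Arm n
  ccwα = lastOf β zs
  ccwβ = lastOf α ys

  transposition : Permutation′ n
  transposition = transpose (short ccwα) (short ccwβ)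

------------------------------------------------------------------------
-- Lines of play

data Play {n : ℕ} (P : Position n) : Set where
  end : ¬ Move P → Play P
  _▸_ : (m : Move P) → Play (Move.result m) → Play P

LineOfPlay : ℕ → Set
LineOfPlay n = Play (start n)

joins : {P : Position n} → Play P → List (Arm n × Arm n)
joins (end _) = []
joins (m ▸ p) = Move.joined m ∷ joins p

transpositions : {P : Position n} → Play P → List (Permutation′ n)
transpositions (end _) = []
transpositions (m ▸ p) = Move.transposition m ∷ transpositions p

-- Equality of unordered pairs.
_≐_ : Arm n × Arm n → Arm n × Arm n → Set
(α , β) ≐ (γ , δ) = (α ≡ γ × β ≡ δ) ⊎ (α ≡ δ × β ≡ γ)

SameLine : LineOfPlay n → LineOfPlay n → Set
SameLine p q = Pointwise _≐_ (joins p) (joins q)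

------------------------------------------------------------------------
-- Factorizations of the long cycle

IsTransposition : Permutation′ n → Set
IsTransposition τ = ∃₂ λ i j → i ≢ j × τ Perm.≈ transpose i j

-- product (t₁ ∷ … ∷ tₖ ∷ []) = tₖ ⋯ t₁ with t₁ applied first, since
-- π ∘ₚ ρ applies π first.
product : List (Permutation′ n) → Permutation′ n
product = foldr _∘ₚ_ Perm.id

-- The cycle (1 2 ⋯ n), i.e. i ↦ i + 1 modulo n.
longCycle : Fin n → Fin n
longCycle {n} i = suc (toℕ i) mod n
  where instance _ = nonZeroIndex i

record IsFactorization (n : ℕ) (ts : List (Permutation′ n)) : Set where
  field
    length≡n∸1      : length ts ≡ n ∸ 1
    transposition   : All IsTransposition ts
    product≗cycle   : product ts ⟨$⟩ʳ_ ≗ longCycle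

permutationSetoid : ℕ → Setoid 0ℓ 0ℓ
permutationSetoid n = record
  { Carrier       = Permutation′ n
  ; _≈_           = Perm._≈_
  ; isEquivalence = record
    { refl  = λ _ → refl
    ; sym   = λ p i → sym (p i)
    ; trans = λ p q i → trans (p i) (q i)
    }
  }

_≋_ : List (Permutation′ n) → List (Permutation′ n) → Set
_≋_ = Pointwise Perm._≈_

-- Factorizations are equal when their sequences are; the proofs that they are
-- factorizations are not compared.
factorizationSetoid : ℕ → Setoid 0ℓ 0ℓ
factorizationSetoid n =
  On.setoid {B = Σ (List (Permutation′ n)) (IsFactorization n)}
    (Pointwise.setoid (permutationSetoid n)) proj₁

{-# OPTIONS --safe #-}
-- Read on short labels, the regions of a position are the cycles of a permutation π, and a move cuts
-- a cycle (A a B b) into (A a) and (B b), which are the cycles of π ∘ (a b), where a and b are the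
-- labels counterclockwise from the joined arms.  Induction on the play gives (1).  Conversely a
-- transposition that joins two cycles would leave too few factors to finish, so the first factor of
-- a factorization of minimal length always cuts a region, which gives (3).  For (2), each short label
-- belongs to exactly one free arm, and the permutation π with these arms is all that matters of a
-- position; the joined labels are the images under π of the points moved by the transposition.
--
-- For the number n ^ (n ∸ 2), record each factor (a b) with a < b by a.  The recorded sequences are
-- the parking functions: when (a b) cuts the region U a W b Z, the letters that still fall in W b
-- number exactly one less than its length, and b is the first position where this happens.  By
-- Pollak's cycle argument every sequence of n − 1 labels has exactly one rotation that is parking,
-- so the parking functions correspond to the sequences beginning with a fixed label.
module Submission where

open import Defs
open import Data.Nat using (ℕ; zero; suc; _+_; _≤_; _<_; _∸_; _^_; z≤n; s≤s)
open import Data.Nat.Properties using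
  (suc-injective; +-suc; +-comm; +-assoc; +-identityʳ; +-cancelˡ-≡; +-cancelʳ-≡;
   +-cancelˡ-≤; +-cancelʳ-≤; +-mono-≤; +-monoʳ-≤; +-monoˡ-≤; ≤-reflexive; ≤-trans; n≤1+n;
   1+n≰n; m≤n+m; _≤?_; ≰⇒>; module ≤-Reasoning)
open import Data.Nat.DivMod using (_%_; m<n⇒m%n≡m; n%n≡0)
open import Data.Fin using (Fin; zero; suc; toℕ; fromℕ; inject₁; finToFun; funToFin; combine)
open import Data.Fin.Properties using
  (_≟_; toℕ-injective; toℕ-fromℕ; toℕ-fromℕ<; toℕ-inject₁; toℕ<n; finToFun-funToFin;
   funToFin-finToFin)
open import Data.Fin.Permutation as Perm using (Permutation′; transpose; _⟨$⟩ʳ_)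
import Data.Fin.Permutation.Components as PC
open import Data.List using
  (List; []; _∷_; _++_; [_]; _∷ʳ_; map; concat; allFin; tabulate; length; lookup)
open import Data.List.Properties using
  (++-identityʳ; ++-assoc; length-++; length-map; map-++; map-cong; map-∘; map-id;
   map-tabulate; length-tabulate; tabulate-cong; tabulate-lookup; ∷-injectiveˡ;
   ∷-injectiveʳ; ++-cancelˡ; ∷ʳ-injective; map-injective)
open import Data.List.Membership.Propositional using (_∈_)
open import Data.List.Membership.Propositional.Properties using
  (∈-++⁻; ∈-++⁺ˡ; ∈-++⁺ʳ; ∈-∃++; ∈-concat⁻′; ∈-allFin; ∈-insert; ∈-map⁻)
open import Data.List.Relation.Unary.All as All using (All; []; _∷_)
import Data.List.Relation.Unary.All.Properties as All
open import Data.List.Relation.Unary.AllPairs using ([]; _∷_)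
open import Data.List.Relation.Unary.Any using (here; there; _─_)
open import Data.List.Relation.Unary.Unique.Propositional using (Unique)
open import Data.List.Relation.Unary.Unique.Propositional.Properties using (allFin⁺)
open import Data.List.Relation.Binary.Pointwise using (Pointwise; []; _∷_)
open import Data.List.Relation.Binary.Permutation.Propositional as ↭ using
  (_↭_; ↭-refl; ↭-prep; ↭-swap; ↭-trans; ↭-sym; ↭-reflexive; ↭⇒↭ₛ)
open import Data.List.Relation.Binary.Permutation.Propositional.Properties as ↭ₚ using
  (↭-length; ++⁺ˡ; ++⁺ʳ; ++-comm; shift; drop-∷; ∈-resp-↭; All-resp-↭)
import Data.List.Relation.Binary.Permutation.Setoid.Properties as PermS
open import Data.Product using (_×_; _,_; proj₁; proj₂; ∃; ∃₂; ∃-syntax; Σ)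
open import Data.Sum using (_⊎_; inj₁; inj₂)
open import Data.Unit using (⊤; tt)
open import Data.Empty using (⊥-elim)
open import Function using (_∘_; id)
open import Function.Bundles using (_⇔_; mk⇔; Bijection)
open import Relation.Binary.Bundles using (module Setoid)
open import Relation.Binary.PropositionalEquality using
  (_≡_; _≢_; _≗_; refl; sym; trans; cong; cong₂; subst; subst₂; setoid; module ≡-Reasoning)
open import Relation.Nullary using (¬_; yes; no; contradiction)
open import Relation.Nullary.Decidable using (dec-true; dec-false)

private
  variable
    n : ℕ
    A : Set
    π ρ : Fin n → Fin n

-- Transpositions as unordered pairs of points.

transpose-left : (i j : Fin n) → PC.transpose i j i ≡ j
transpose-left i j rewrite dec-true (i ≟ i) refl = refl

transpose-right : (i j : Fin n) → PC.transpose i j j ≡ i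
transpose-right i j with j ≟ i
... | yes p = p
... | no _ rewrite dec-true (j ≟ j) refl = refl

transpose-other : {i j k : Fin n} → k ≢ i → k ≢ j → PC.transpose i j k ≡ k
transpose-other {i = i} {j} {k} k≢i k≢j
  rewrite dec-false (k ≟ i) k≢i | dec-false (k ≟ j) k≢j = refl

transpose-comm : (i j : Fin n) → transpose i j Perm.≈ transpose j i
transpose-comm i j k = go (k ≟ i) (k ≟ j)
  where
  go : _ → _ → PC.transpose i j k ≡ PC.transpose j i k
  go (yes refl) _ = trans (transpose-left k j) (sym (transpose-right j k))
  go (no _) (yes refl) = trans (transpose-right i k) (sym (transpose-left k i))
  go (no k≢i) (no k≢j) = trans (transpose-other k≢i k≢j) (sym (transpose-other k≢j k≢i))

transpose-determines : {i j i′ j′ : Fin n} → i ≢ j → transpose i j Perm.≈ transpose i′ j′ →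
  (i ≡ i′ × j ≡ j′) ⊎ (i ≡ j′ × j ≡ i′)
transpose-determines {i = i} {j} {i′} {j′} i≢j eq = go (i ≟ i′) (i ≟ j′)
  where
  at-i : PC.transpose i′ j′ i ≡ j
  at-i = trans (sym (eq i)) (transpose-left i j)
  go : _ → _ → _
  go (yes refl) _ = inj₁ (refl , trans (sym at-i) (transpose-left i′ j′))
  go (no _) (yes refl) = inj₂ (refl , trans (sym at-i) (transpose-right i′ j′))
  go (no p) (no q) = contradiction (trans (sym (transpose-other p q)) at-i) i≢j

-- Positions described by short labels only

-- The default is the point to which a path leads after its last entry, so the successor of an entry
-- needs no case distinction.
hd : A → List A → A
hd w []      = w
hd w (x ∷ _) = x

hd-++ : ∀ (w : A) xs ys → hd w (xs ++ ys) ≡ hd (hd w ys) xs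
hd-++ w []      ys = refl
hd-++ w (_ ∷ _) ys = refl

-- The exit point `w` stays a parameter so that paths can be cut and concatenated; closing a path
-- into a cycle means choosing its own head as exit.
Path : (Fin n → Fin n) → List (Fin n) → Fin n → Set
Path π []       w = ⊤
Path π (x ∷ xs) w = π x ≡ hd w xs × Path π xs w

Path-++⁻ : ∀ xs {ys w} → Path {n} π (xs ++ ys) w → Path π xs (hd w ys) × Path π ys w
Path-++⁻ [] p = tt , p
Path-++⁻ (x ∷ xs) {ys} {w} (e , p) =
  let q , r = Path-++⁻ xs p in (trans e (hd-++ w xs ys) , q) , r

Path-++⁺ : ∀ xs {ys w} → Path {n} π xs (hd w ys) → Path π ys w → Path π (xs ++ ys) w
Path-++⁺ [] _ q = q
Path-++⁺ (x ∷ xs) {ys} {w} (e , p) q = trans e (sym (hd-++ w xs ys)) , Path-++⁺ xs p q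

Path-cong : ∀ {xs w} → All (λ x → π x ≡ ρ x) xs → Path {n} π xs w → Path ρ xs w
Path-cong [] p = tt
Path-cong (e ∷ es) (f , p) = trans (sym e) f , Path-cong es p

-- The quantifier over `w` only serves as a default for `hd`; on a nonempty list its value does not
-- matter.
Cycle : (Fin n → Fin n) → List (Fin n) → Set
Cycle π xs = xs ≢ [] × (∀ w → Path π xs (hd w xs))

∷ʳ≢[] : ∀ (xs : List A) {x} → xs ∷ʳ x ≢ []
∷ʳ≢[] [] ()
∷ʳ≢[] (_ ∷ _) ()

Cycle-cong : ∀ {xs} → All (λ x → π x ≡ ρ x) xs → Cycle {n} π xs → Cycle ρ xs
Cycle-cong es (ne , p) = ne , λ w → Path-cong es (p w)

Cycle-rotate : ∀ xs ys → Cycle {n} π (xs ++ ys) → Cycle π (ys ++ xs)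
Cycle-rotate {π = π} [] ys c = subst (Cycle π) (sym (++-identityʳ ys)) c
Cycle-rotate {π = π} (x ∷ xs) [] c = subst (Cycle π) (++-identityʳ (x ∷ xs)) c
Cycle-rotate (x ∷ xs) (y ∷ ys) (_ , p) =
  (λ ()) , λ w → let q , r = Path-++⁻ (x ∷ xs) (p w) in Path-++⁺ (y ∷ ys) r q

Cycle-∷ʳ⁺ : ∀ {xs x} → Path {n} π xs x → π x ≡ hd x xs → Cycle π (xs ∷ʳ x)
Cycle-∷ʳ⁺ {xs = xs} {x} p e =
  ∷ʳ≢[] xs , λ w → Path-++⁺ xs p (trans e (sym (hd-++ w xs [ x ])) , tt)

Cycle-∷ʳ⁻ : ∀ {xs x} → Cycle {n} π (xs ∷ʳ x) → Path π xs x × π x ≡ hd x xs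
Cycle-∷ʳ⁻ {xs = xs} {x} (_ , p) =
  let q , e , _ = Path-++⁻ xs (p x) in q , trans e (hd-++ x xs [ x ])

Cycle-++⁻ : ∀ {xs x ys y} → Cycle {n} π ((xs ∷ʳ x) ++ (ys ∷ʳ y)) →
  Path π xs x × π x ≡ hd y ys × Path π ys y × π y ≡ hd x xs
Cycle-++⁻ {xs = xs} {x} {ys} {y} (_ , p) =
  let p₁ , p₂ = Path-++⁻ (xs ∷ʳ x) (p x)
      q₁ , e₁ , _ = Path-++⁻ xs p₁
      q₂ , e₂ , _ = Path-++⁻ ys p₂
  in q₁ , trans e₁ (hd-++ _ ys [ y ]) ,
     q₂ , trans e₂ (trans (hd-++ x (xs ∷ʳ x) (ys ∷ʳ y)) (hd-++ _ xs [ x ]))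

Cycle-++⁺ : ∀ {xs x ys y} → Path {n} π xs x → π x ≡ hd y ys → Path π ys y → π y ≡ hd x xs →
  Cycle π ((xs ∷ʳ x) ++ (ys ∷ʳ y))
Cycle-++⁺ {xs = xs} {x} {ys} {y} q₁ e₁ q₂ e₂ =
  (λ eq → ∷ʳ≢[] ((xs ∷ʳ x) ++ ys) (trans (++-assoc (xs ∷ʳ x) ys [ y ]) eq)) , λ w →
  Path-++⁺ (xs ∷ʳ x)
    (Path-++⁺ xs q₁ (trans e₁ (sym (hd-++ _ ys [ y ])) , tt))
    (Path-++⁺ ys q₂ (trans e₂ (sym (trans (hd-++ w (xs ∷ʳ x) (ys ∷ʳ y)) (hd-++ _ xs [ x ]))) , tt))

-- Regions as the cycles of a permutation: cutting and merging.

LabelPosition : ℕ → Set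
LabelPosition n = List (List (Fin n))

Unique-resp-↭ : {xs ys : List A} → xs ↭ ys → Unique xs → Unique ys
Unique-resp-↭ p = PermS.Unique-resp-↭ (setoid _) (↭⇒↭ₛ p)

concat-↭ : {xss yss : List (List A)} → xss ↭ yss → concat xss ↭ concat yss
concat-↭ ↭.refl = ↭-refl
concat-↭ (↭.prep xs p) = ++⁺ˡ xs (concat-↭ p)
concat-↭ (↭.swap xs ys p) = ↭-trans (↭ₚ.shifts xs ys) (++⁺ˡ ys (++⁺ˡ xs (concat-↭ p)))
concat-↭ (↭.trans p q) = ↭-trans (concat-↭ p) (concat-↭ q)

-- Since each label occurs exactly once, the lists of `P` are all the cycles of `π`, fixed points
-- included, each written from some starting entry.
record Config {n} (π : Fin n → Fin n) (P : LabelPosition n) : Set where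
  constructor config
  field
    labels : concat P ↭ allFin n
    cycles : All (Cycle π) P

  unique : Unique (concat P)
  unique = Unique-resp-↭ (↭-sym labels) (allFin⁺ n)

  covers : ∀ i → i ∈ concat P
  covers i = ∈-resp-↭ (↭-sym labels) (∈-allFin i)
open Config

Config-↭ : ∀ {P Q} → P ↭ Q → Config {n} π P → Config π Q
Config-↭ p (config l c) = config (↭-trans (concat-↭ (↭-sym p)) l) (All-resp-↭ p c)

Config-rotate : ∀ xs ys {Q} → Config {n} π ((xs ++ ys) ∷ Q) → Config π ((ys ++ xs) ∷ Q)
Config-rotate xs ys {Q} (config l (c ∷ cs)) =
  config (↭-trans (++⁺ʳ (concat Q) (++-comm ys xs)) l) (Cycle-rotate xs ys c ∷ cs)

Config-cong : ∀ {P} → π ≗ ρ → Config {n} π P → Config ρ P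
Config-cong eq (config l cs) =
  config l (All.map (Cycle-cong (All.tabulate λ {x} _ → eq x)) cs)

module _ (A : List (Fin n)) (a : Fin n) (B : List (Fin n)) (b : Fin n) (Q : LabelPosition n)
         (u : Unique (((A ∷ʳ a) ++ (B ∷ʳ b)) ++ concat Q)) where
  private
    to-front : ((A ∷ʳ a) ++ (B ∷ʳ b)) ++ concat Q ↭ a ∷ b ∷ (A ++ B ++ concat Q)
    to-front = begin
      ((A ∷ʳ a) ++ (B ∷ʳ b)) ++ concat Q ≡⟨ ++-assoc (A ∷ʳ a) (B ∷ʳ b) (concat Q) ⟩
      (A ∷ʳ a) ++ (B ∷ʳ b) ++ concat Q   ≡⟨ ++-assoc A [ a ] _ ⟩
      A ++ a ∷ (B ∷ʳ b) ++ concat Q      ↭⟨ shift a A _ ⟩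
      a ∷ A ++ (B ∷ʳ b) ++ concat Q      ≡⟨ cong (λ C → a ∷ A ++ C) (++-assoc B [ b ] _) ⟩
      a ∷ A ++ B ++ b ∷ concat Q         ≡⟨ cong (a ∷_) (++-assoc A B _) ⟨
      a ∷ (A ++ B) ++ b ∷ concat Q       ↭⟨ ↭-prep a (shift b (A ++ B) _) ⟩
      a ∷ b ∷ (A ++ B) ++ concat Q       ≡⟨ cong (λ C → a ∷ b ∷ C) (++-assoc A B _) ⟩
      a ∷ b ∷ A ++ B ++ concat Q         ∎
      where open ↭.PermutationReasoning

  ends-distinct : a ≢ b
  ends-distinct with Unique-resp-↭ to-front u
  ... | (a≢b ∷ _) ∷ _ = a≢b

  ends-fresh : ∀ (π : Fin n → Fin n) → let agree = λ x → π x ≡ π (PC.transpose a b x) in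
    All agree A × All agree B × All (All agree) Q
  ends-fresh π with Unique-resp-↭ to-front u
  ... | (_ ∷ as) ∷ bs ∷ _ =
    let all = All.zipWith (λ (p , q) → cong π (sym (transpose-other (p ∘ sym) (q ∘ sym)))) (as , bs)
        onA , rest = All.++⁻ A all
        onB , onQ  = All.++⁻ B rest
    in onA , onB , All.concat⁻ onQ

  private
    at-a : ∀ (π : Fin n → Fin n) → π (PC.transpose a b a) ≡ π b
    at-a π = cong π (transpose-left a b)
    at-b : ∀ (π : Fin n → Fin n) → π (PC.transpose a b b) ≡ π a
    at-b π = cong π (transpose-right a b)
    others : ∀ {Q′} → All (All (λ x → π x ≡ π (PC.transpose a b x))) Q′ → All (Cycle π) Q′ →
      All (Cycle (π ∘ PC.transpose a b)) Q′
    others es cs = All.zipWith (λ (e , c) → Cycle-cong e c) (es , cs)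

  -- Composing with the transposition changes `π` only at the two ends, whose images are exchanged:
  -- `a` now returns to the head of its own half, and so does `b`.
  cycles-cut : All (Cycle π) (((A ∷ʳ a) ++ (B ∷ʳ b)) ∷ Q) →
    All (Cycle (π ∘ PC.transpose a b)) ((A ∷ʳ a) ∷ (B ∷ʳ b) ∷ Q)
  cycles-cut {π = π} (c ∷ cs) =
    let onA , onB , onQ = ends-fresh π
        p₁ , e₁ , p₂ , e₂ = Cycle-++⁻ {xs = A} {ys = B} c
    in Cycle-∷ʳ⁺ (Path-cong onA p₁) (trans (at-a π) e₂) ∷
       Cycle-∷ʳ⁺ (Path-cong onB p₂) (trans (at-b π) e₁) ∷ others onQ cs

  -- The same exchange of images read the other way: each end is redirected to the head of the other
  -- cycle.
  cycles-merge : All (Cycle π) ((A ∷ʳ a) ∷ (B ∷ʳ b) ∷ Q) →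
    All (Cycle (π ∘ PC.transpose a b)) (((A ∷ʳ a) ++ (B ∷ʳ b)) ∷ Q)
  cycles-merge {π = π} (c₁ ∷ c₂ ∷ cs) =
    let onA , onB , onQ = ends-fresh π
        p₁ , e₁ = Cycle-∷ʳ⁻ {xs = A} c₁
        p₂ , e₂ = Cycle-∷ʳ⁻ {xs = B} c₂
    in Cycle-++⁺ (Path-cong onA p₁) (trans (at-a π) e₂) (Path-cong onB p₂) (trans (at-b π) e₁) ∷ others onQ cs

Config-cut : ∀ A (a : Fin n) B b Q → Config π (((A ∷ʳ a) ++ (B ∷ʳ b)) ∷ Q) →
  Config (π ∘ PC.transpose a b) ((A ∷ʳ a) ∷ (B ∷ʳ b) ∷ Q)
Config-cut A a B b Q c = config
  (↭-trans (↭-reflexive (sym (++-assoc (A ∷ʳ a) (B ∷ʳ b) (concat Q)))) (labels c))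
  (cycles-cut A a B b Q (unique c) (cycles c))

Config-merge : ∀ A (a : Fin n) B b Q → Config π ((A ∷ʳ a) ∷ (B ∷ʳ b) ∷ Q) →
  Config (π ∘ PC.transpose a b) (((A ∷ʳ a) ++ (B ∷ʳ b)) ∷ Q)
Config-merge A a B b Q c = config (↭-trans (↭-reflexive assoc) (labels c))
  (cycles-merge A a B b Q (subst Unique (sym assoc) (unique c)) (cycles c))
  where assoc = ++-assoc (A ∷ʳ a) (B ∷ʳ b) (concat Q)

-- Reading the cycle as Z, U, a, W, b reduces this to `Config-cut`. Rotating back afterwards leaves
-- both pieces in the linear order inherited from the original list, on which the parking functions
-- rely.
Config-split : ∀ U (a : Fin n) W b Z {Q} → Config π ((U ++ a ∷ W ++ b ∷ Z) ∷ Q) →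
  Config (π ∘ PC.transpose a b) ((U ++ a ∷ Z) ∷ (W ∷ʳ b) ∷ Q)
Config-split {n = n} {π = π} U a W b Z {Q} c =
  subst (λ X → Config _ (X ∷ (W ∷ʳ b) ∷ Q)) (++-assoc U [ a ] Z)
    (Config-rotate Z (U ∷ʳ a)
      (subst (λ X → Config _ (X ∷ (W ∷ʳ b) ∷ Q)) (++-assoc Z U [ a ])
        (Config-cut (Z ++ U) a W b Q
          (subst (λ X → Config π (X ∷ Q)) to-cut
            (Config-rotate (U ++ a ∷ W ∷ʳ b) Z
              (subst (λ X → Config π (X ∷ Q)) from-linear c))))))
  where
  from-linear : U ++ a ∷ W ++ b ∷ Z ≡ (U ++ a ∷ W ∷ʳ b) ++ Z
  from-linear = trans (cong (λ V → U ++ a ∷ V) (sym (++-assoc W [ b ] Z))) (sym (++-assoc U _ Z))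
  to-cut : Z ++ U ++ a ∷ W ∷ʳ b ≡ ((Z ++ U) ∷ʳ a) ++ (W ∷ʳ b)
  to-cut = trans (sym (++-assoc Z U _)) (sym (++-assoc (Z ++ U) [ a ] _))

lastOf-∷ʳ : ∀ (x : A) xs → ∃ λ ys → x ∷ xs ≡ ys ∷ʳ lastOf x xs
lastOf-∷ʳ x [] = [] , refl
lastOf-∷ʳ x (y ∷ xs) = let ys , eq = lastOf-∷ʳ y xs in x ∷ ys , cong (x ∷_) eq

∷ʳ-lastOf : ∀ (xs : List A) x → ∃₂ λ y ys → xs ∷ʳ x ≡ y ∷ ys × lastOf y ys ≡ x
∷ʳ-lastOf [] x = x , [] , refl , refl
∷ʳ-lastOf (z ∷ []) x = z , [ x ] , refl , refl
∷ʳ-lastOf (z ∷ w ∷ xs) x with ∷ʳ-lastOf (w ∷ xs) x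
... | y , ys , refl , eq = z , y ∷ ys , refl , eq

lastOf-map : ∀ {B : Set} (f : A → B) x xs → lastOf (f x) (map f xs) ≡ f (lastOf x xs)
lastOf-map f x [] = refl
lastOf-map f x (y ∷ xs) = lastOf-map f y xs

Config-cut-lastOf : ∀ (x : Fin n) xs y ys Q → Config π (((x ∷ xs) ++ (y ∷ ys)) ∷ Q) →
  lastOf x xs ≢ lastOf y ys ×
  Config (π ∘ PC.transpose (lastOf x xs) (lastOf y ys)) ((x ∷ xs) ∷ (y ∷ ys) ∷ Q)
Config-cut-lastOf {n = n} {π = π} x xs y ys Q c with lastOf-∷ʳ x xs | lastOf-∷ʳ y ys
... | A , eqA | B , eqB =
  ends-distinct A _ B _ Q (unique c′) ,
  subst₂ (λ X Y → Config _ (X ∷ Y ∷ Q)) (sym eqA) (sym eqB) (Config-cut A _ B _ Q c′)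
  where
  c′ = subst₂ (λ X Y → Config π ((X ++ Y) ∷ Q)) eqA eqB c

-- Counting cycles: the factors of a minimal factorization only cut.

Singleton : List A → Set
Singleton xs = ∃ λ x → xs ≡ [ x ]

fixed⇒singletons : ∀ {P} → π ≗ id → Unique (concat P) → All (Cycle {n} π) P → All Singleton P
fixed⇒singletons π≗id u [] = []
fixed⇒singletons {P = [] ∷ P} π≗id u (c ∷ cs) = contradiction refl (proj₁ c)
fixed⇒singletons {P = (x ∷ []) ∷ P} π≗id (_ ∷ u) (c ∷ cs) =
  (x , refl) ∷ fixed⇒singletons π≗id u cs
fixed⇒singletons {P = (x ∷ y ∷ xs) ∷ P} π≗id ((x≢y ∷ _) ∷ _) ((_ , p) ∷ cs) =
  contradiction (trans (sym (π≗id x)) (proj₁ (p x))) x≢y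

singletons⇒fixed : ∀ {P} → Config {n} π P → All Singleton P → π ≗ id
singletons⇒fixed {P = P} c ss i with ∈-concat⁻′ P (covers c i)
... | X , i∈X , X∈P with All.lookup ss X∈P | All.lookup (cycles c) X∈P
singletons⇒fixed c ss i | X , here refl , X∈P | x , refl | _ , p = proj₁ (p x)

length-concat-singletons : {xss : List (List A)} → All Singleton xss → length (concat xss) ≡ length xss
length-concat-singletons [] = refl
length-concat-singletons ((_ , refl) ∷ ss) = cong suc (length-concat-singletons ss)

Config-length : ∀ {P} → Config {n} π P → length (concat P) ≡ n
Config-length {n = n} c = trans (↭-length (labels c)) (length-tabulate {n = n} id)

extract : ∀ {x : A} {xs} → x ∈ xs → ∃ λ ys → xs ↭ x ∷ ys
extract {x = x} x∈xs with ∈-∃++ x∈xs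
... | ys , zs , refl = ys ++ zs , shift x ys zs

split-at-two : ∀ {x y : A} {xs} → x ≢ y → x ∈ xs → y ∈ xs → ∃ λ U → ∃₂ λ W Z →
  xs ≡ U ++ x ∷ W ++ y ∷ Z ⊎ xs ≡ U ++ y ∷ W ++ x ∷ Z
split-at-two {x = x} {y} x≢y x∈xs y∈xs with ∈-∃++ x∈xs
... | U , V , refl with ∈-++⁻ U y∈xs
...   | inj₁ y∈U with ∈-∃++ y∈U
...     | U₁ , U₂ , refl = U₁ , U₂ , V , inj₂ (++-assoc U₁ (y ∷ U₂) (x ∷ V))
split-at-two x≢y _ _ | U , V , refl | inj₂ (here refl) = contradiction refl x≢y
split-at-two x≢y _ _ | U , V , refl | inj₂ (there y∈V) with ∈-∃++ y∈V
... | W , Z , refl = U , W , Z , inj₁ refl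

transpose-involutive : ∀ (i j k : Fin n) → PC.transpose i j (PC.transpose i j k) ≡ k
transpose-involutive i j k =
  trans (cong (PC.transpose i j) (transpose-comm i j k)) (PC.transpose-inverse i j)

-- Since t₁ is applied first, removing it from the sequence replaces π by π ∘ t₁.
product-tail : ∀ {t : Permutation′ n} {ts i j} → t Perm.≈ transpose i j →
  product (t ∷ ts) ⟨$⟩ʳ_ ≗ π → product ts ⟨$⟩ʳ_ ≗ π ∘ PC.transpose i j
product-tail {t = t} {ts} {i} {j} t≈ eq k = sym (trans (sym (eq _))
  (cong (product ts ⟨$⟩ʳ_) (trans (t≈ _) (transpose-involutive i j k))))

Together : LabelPosition n → Fin n → Fin n → Set
Together P i j = ∃ λ U → ∃₂ λ W Z → (U ++ i ∷ W ++ j ∷ Z) ∈ P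

Apart : LabelPosition n → Fin n → Fin n → Set
Apart P i j = ∃₂ λ X Y → ∃ λ Q → P ↭ X ∷ Y ∷ Q × i ∈ X × j ∈ Y

locate : ∀ {P} {i j : Fin n} → i ≢ j → Config π P → (Together P i j ⊎ Together P j i) ⊎ Apart P i j
locate {P = P} {i} {j} i≢j c with ∈-concat⁻′ P (covers c i)
... | X , i∈X , X∈P with extract X∈P
...   | Q , P↭XQ with ∈-++⁻ X (∈-resp-↭ (concat-↭ P↭XQ) (covers c j))
...     | inj₁ j∈X with split-at-two i≢j i∈X j∈X
...       | U , W , Z , inj₁ refl = inj₁ (inj₁ (U , W , Z , X∈P))
...       | U , W , Z , inj₂ refl = inj₁ (inj₂ (U , W , Z , X∈P))
locate i≢j c | X , i∈X , X∈P | Q , P↭XQ | inj₂ j∈Q with ∈-concat⁻′ Q j∈Q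
... | Y , j∈Y , Y∈Q with extract Y∈Q
...   | Q′ , Q↭YQ′ = inj₂ (X , Y , Q′ , ↭-trans P↭XQ (↭-prep X Q↭YQ′) , i∈X , j∈Y)

Config-Together : ∀ {P} {i j : Fin n} → Config π P → Together P i j → ∃ λ P′ →
  Config (π ∘ PC.transpose i j) P′ × length P′ ≡ suc (length P)
Config-Together {i = i} {j} c (U , W , Z , X∈P) =
  let Q , P↭ = extract X∈P in
  _ , Config-split U i W j Z (Config-↭ P↭ c) , cong suc (sym (↭-length P↭))

-- Both cycles are first rotated until `i` and `j` stand last, the form in which `Config-merge`
-- applies.
Config-Apart : ∀ {P} {i j : Fin n} → Config π P → Apart P i j → ∃ λ P′ →
  Config (π ∘ PC.transpose i j) P′ × suc (length P′) ≡ length P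
Config-Apart {π = π} {i = i} {j} c (X , Y , Q , P↭ , i∈X , j∈Y) with ∈-∃++ i∈X | ∈-∃++ j∈Y
... | U , V , refl | U′ , V′ , refl = _ , Config-merge (V ++ U) i (V′ ++ U′) j Q c₂ , sym (↭-length P↭)
  where
  to-end : ∀ U x V {Q} → Config π ((U ++ x ∷ V) ∷ Q) → Config π (((V ++ U) ∷ʳ x) ∷ Q)
  to-end U x V {Q} c =
    subst (λ X → Config π (X ∷ Q)) (sym (++-assoc V U [ x ]))
      (Config-rotate (U ∷ʳ x) V (subst (λ X → Config π (X ∷ Q)) (sym (++-assoc U [ x ] V)) c))
  c₁ = to-end U i V (Config-↭ P↭ c)
  c₂ = Config-↭ (↭-swap _ _ ↭-refl) (to-end U′ j V′ (Config-↭ (↭-swap _ _ ↭-refl) c₁))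

Config-transpose : ∀ {P} {i j : Fin n} → i ≢ j → Config π P → ∃ λ P′ →
  Config (π ∘ PC.transpose i j) P′ × length P′ ≤ suc (length P)
Config-transpose {π = π} {i = i} {j} i≢j c with locate i≢j c
... | inj₁ (inj₁ together) =
  let P′ , c′ , len = Config-Together c together in P′ , c′ , ≤-reflexive len
... | inj₁ (inj₂ together) =
  let P′ , c′ , len = Config-Together c together in
  P′ , Config-cong (cong π ∘ transpose-comm j i) c′ , ≤-reflexive len
... | inj₂ apart =
  let P′ , c′ , len = Config-Apart c apart in
  P′ , c′ , ≤-trans (n≤1+n _) (≤-trans (≤-reflexive len) (n≤1+n _))

-- Taking off one factor raises the number of cycles by at most one, and the identity, reached when
-- no factor remains, has `n` cycles.
product-length-bound : ∀ (ts : List (Permutation′ n)) {P} → Config π P → All IsTransposition ts →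
  product ts ⟨$⟩ʳ_ ≗ π → n ≤ length ts + length P
product-length-bound [] c [] eq = ≤-reflexive (trans (sym (Config-length c))
  (length-concat-singletons (fixed⇒singletons (sym ∘ eq) (unique c) (cycles c))))
product-length-bound (t ∷ ts) {P} c ((i , j , i≢j , t≈) ∷ trs) eq =
  let P′ , c′ , len = Config-transpose i≢j c in
  ≤-trans (product-length-bound ts c′ trs (product-tail {t = t} {ts} t≈ eq))
    (≤-trans (+-monoʳ-≤ (length ts) len) (≤-reflexive (+-suc (length ts) (length P))))

-- If the first factor merged two cycles, one factor would be spent and one cycle lost, so the
-- remaining factors would fall two short of `product-length-bound`.
minimal⇒together : ∀ {t : Permutation′ n} {ts P} → Config π P → All IsTransposition (t ∷ ts) →
  product (t ∷ ts) ⟨$⟩ʳ_ ≗ π → length (t ∷ ts) + length P ≡ n →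
  ∃₂ λ i j → t Perm.≈ transpose i j × Together P i j
minimal⇒together {t = t} {ts} {P} c ((i , j , i≢j , t≈) ∷ trs) eq len with locate i≢j c
... | inj₁ (inj₁ together) = i , j , t≈ , together
... | inj₁ (inj₂ together) = j , i , (λ k → trans (t≈ k) (transpose-comm i j k)) , together
... | inj₂ apart =
  let P′ , c′ , len′ = Config-Apart c apart in
  contradiction
    (≤-trans (≤-reflexive (trans (sym (+-suc (length ts) _)) (cong (length ts +_) len′)))
      (≤-trans (n≤1+n _) (≤-trans (≤-reflexive len)
        (product-length-bound ts c′ trs (product-tail {t = t} {ts} t≈ eq)))))
    (1+n≰n {length ts + length P′})

-- Plays

Path-lastOf : ∀ (x : Fin n) xs {w} → Path π (x ∷ xs) w → π (lastOf x xs) ≡ w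
Path-lastOf x [] (e , _) = e
Path-lastOf x (y ∷ xs) (_ , p) = Path-lastOf y xs p

labelsOf : Position n → LabelPosition n
labelsOf = map (map short)

∈⇒↭─ : ∀ {x : A} {xs} (x∈xs : x ∈ xs) → xs ↭ x ∷ (xs ─ x∈xs)
∈⇒↭─ (here refl) = ↭-refl
∈⇒↭─ (there x∈xs) = ↭-trans (↭-prep _ (∈⇒↭─ x∈xs)) (↭-swap _ _ ↭-refl)

module _ {P : Position n} (m : Move P) where
  open Move m

  private
    -- Starting at `β` makes `ccwα` and `ccwβ` the last entries of the two halves, in the order in
    -- which they appear in `transposition`.
    clockwise-labels : Config π (labelsOf P) →
      Config π (((short β ∷ map short zs) ++ (short α ∷ map short ys)) ∷ labelsOf (P ─ region∈P))
    clockwise-labels {π = π} c with clockwise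
    ... | us , vs , r≡ , s≡ =
      Config-rotate (short α ∷ map short ys) (short β ∷ map short zs)
        (subst (λ X → Config π (X ∷ labelsOf (P ─ region∈P))) (trans (sym (map-++ short vs us))
            (trans (cong (map short) (sym s≡)) (map-++ short (α ∷ ys) (β ∷ zs))))
          (Config-rotate (map short us) (map short vs)
            (subst (λ X → Config π (X ∷ labelsOf (P ─ region∈P))) (trans (cong (map short) r≡) (map-++ short us vs))
              (Config-↭ (↭ₚ.map⁺ (map short) (∈⇒↭─ region∈P)) c))))

  -- A new arm has the short label of the arm it replaces, so the two new regions read exactly like
  -- the two halves of the cut cycle.
  Config-move : Config π (labelsOf P) → short ccwα ≢ short ccwβ ×
    Config (π ∘ PC.transpose (short ccwα) (short ccwβ)) (labelsOf result)
  Config-move {π = π} c with Config-cut-lastOf _ _ _ _ _ (clockwise-labels c)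
  ... | distinct , c′ rewrite lastOf-map short β zs | lastOf-map short α ys =
    distinct , Config-↭ (↭-swap _ _ ↭-refl) c′

  -- The entry after `ccwα` in clockwise order is `α`. This is how a transposition reveals the
  -- labels of the arms that were joined.
  short-ccwα : Config π (labelsOf P) → π (short ccwα) ≡ short α
  short-ccwα {π = π} c with clockwise-labels c
  ... | config _ ((_ , p) ∷ _) = subst (λ i → π i ≡ short α) (lastOf-map short β zs)
    (Path-lastOf (short β) (map short zs)
      (proj₁ (Path-++⁻ (short β ∷ map short zs) (p (short α)))))

  short-ccwβ : Config π (labelsOf P) → π (short ccwβ) ≡ short β
  short-ccwβ {π = π} c
    with Config-rotate (short β ∷ map short zs) (short α ∷ map short ys) (clockwise-labels c)
  ... | config _ ((_ , p) ∷ _) = subst (λ i → π i ≡ short β) (lastOf-map short α ys)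
    (Path-lastOf (short α) (map short ys)
      (proj₁ (Path-++⁻ (short α ∷ map short ys) (p (short α)))))

  -- Uniqueness compares the head of a list with all the rest, so the region is read once from `β`
  -- and once from `α`.
  short-distinct : Config π (labelsOf P) →
    let fresh = λ γ → short γ ≢ short α × short γ ≢ short β in
    short α ≢ short β × All fresh ys × All fresh zs × All (All fresh) (P ─ region∈P)
  short-distinct c
    with unique (clockwise-labels c)
       | unique (Config-rotate (short β ∷ map short zs) (short α ∷ map short ys) (clockwise-labels c))
  ... | β≢ ∷ _ | α≢ ∷ _ with All.++⁻ (map short zs ++ short α ∷ map short ys) β≢
                           | All.++⁻ (map short ys ++ short β ∷ map short zs) α≢
  ... | β≢₁ , β≢Q | α≢₁ , α≢Q with All.++⁻ (map short zs) β≢₁ | All.++⁻ (map short ys) α≢₁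
  ... | β≢zs , _ ∷ β≢ys | α≢ys , α≢β ∷ α≢zs =
    α≢β , both α≢ys β≢ys , both α≢zs β≢zs ,
    All.zipWith (λ (p , q) → both p q)
      (All.map⁻ (All.concat⁻ {xss = labelsOf (P ─ region∈P)} α≢Q) ,
       All.map⁻ (All.concat⁻ {xss = labelsOf (P ─ region∈P)} β≢Q))
    where
    both : ∀ {xs} → All (short α ≢_) (map short xs) → All (short β ≢_) (map short xs) →
      All (λ γ → short γ ≢ short α × short γ ≢ short β) xs
    both p q = All.zipWith (λ (p , q) → p ∘ sym , q ∘ sym) (All.map⁻ p , All.map⁻ q)

stuck⇒singletons : ∀ {P : Position n} → ¬ Move P → All (Cycle π) (labelsOf P) → All Singleton (labelsOf P)
stuck⇒singletons {P = P} stuck cs = All.map⁺ (All.tabulate single)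
  where
  single : ∀ {R} → R ∈ P → Singleton (map short R)
  single {[]} R∈P = contradiction refl (proj₁ (All.lookup (All.map⁻ cs) R∈P))
  single {α ∷ []} R∈P = short α , refl
  single {α ∷ β ∷ zs} R∈P = ⊥-elim (stuck record
    { region∈P = R∈P ; α = α ; β = β ; ys = [] ; zs = zs
    ; clockwise = [] , α ∷ β ∷ zs , refl , sym (++-identityʳ _) })

-- Every move contributes one factor and one additional region, which keeps the sum of both
-- constant; a finished game has one region for each label.
play-factorization : ∀ {P : Position n} (p : Play P) → Config π (labelsOf P) →
  length (transpositions p) + length P ≡ n × All IsTransposition (transpositions p) ×
  product (transpositions p) ⟨$⟩ʳ_ ≗ π
play-factorization {P = P} (end stuck) c =
  trans (sym (length-map (map short) P)) (trans (sym (length-concat-singletons ss)) (Config-length c)) ,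
  [] , sym ∘ singletons⇒fixed c ss
  where ss = stuck⇒singletons stuck (cycles c)
play-factorization {π = π} {P = P} (m ▸ p) c =
  let distinct , c′ = Config-move m c
      len , trs , eq = play-factorization p c′
  in trans (cong (λ k → suc (length (transpositions p) + k)) (↭-length (∈⇒↭─ region∈P)))
       (trans (sym (+-suc (length (transpositions p)) _)) len) ,
     (_ , _ , distinct , λ _ → refl) ∷ trs ,
     λ k → trans (eq _) (cong π (transpose-involutive _ _ k))
  where open Move m

map≡++∷⁻ : ∀ {A B : Set} (f : A → B) xs {U b V} → map f xs ≡ U ++ b ∷ V → ∃ λ U′ → ∃₂ λ a V′ →
  xs ≡ U′ ++ a ∷ V′ × f a ≡ b × map f V′ ≡ V
map≡++∷⁻ f (x ∷ xs) {[]} refl = [] , x , xs , refl , refl , refl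
map≡++∷⁻ f (x ∷ xs) {_ ∷ U} eq with map≡++∷⁻ f xs {U} (∷-injectiveʳ eq)
... | U′ , a , V′ , refl , e₁ , e₂ = x ∷ U′ , a , V′ , refl , e₁ , e₂

-- The given labels are those counterclockwise from the joined arms. Hence the arms to join are the
-- next ones clockwise: `β` follows the arm labelled `i`, and `α` follows the arm labelled `j`,
-- possibly after passing the end of the list.
Together⇒move : ∀ {P : Position n} {i j} → Together (labelsOf P) i j →
  ∃ λ (m : Move P) → short (Move.ccwα m) ≡ j × short (Move.ccwβ m) ≡ i
Together⇒move {P = P} {i} {j} (U , W , Z , X∈) with ∈-map⁻ (map short) X∈
... | R , R∈P , eq with map≡++∷⁻ short R {U} (sym eq)
... | U′ , a , V′ , refl , refl , eq′ with map≡++∷⁻ short V′ {W} eq′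
... | W′ , b , Z′ , refl , refl , _ with ∷ʳ-lastOf (Z′ ++ U′) a | ∷ʳ-lastOf W′ b
... | α , ys , eqα , refl | β , zs , eqβ , refl = record
  { region∈P = R∈P ; α = α ; β = β ; ys = ys ; zs = zs
  ; clockwise = U′ ++ a ∷ W′ ∷ʳ b , Z′ ,
      trans (cong (λ V → U′ ++ a ∷ V) (sym (++-assoc W′ [ b ] Z′))) (sym (++-assoc U′ _ Z′)) ,
      trans (cong₂ _++_ (sym eqα) (sym eqβ))
        (trans (++-assoc (Z′ ++ U′) [ a ] _) (++-assoc Z′ U′ _))
  } , refl , refl

region-length : ∀ {P : Position n} (m : Move P) → 2 ≤ length (Move.region m)
region-length m with Move.clockwise m
... | us , vs , refl , eq = begin
  2                         ≤⟨ s≤s (s≤s z≤n) ⟩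
  suc (suc (length ys + length zs)) ≡⟨ cong suc (+-suc (length ys) _) ⟨
  suc (length ys + suc (length zs)) ≡⟨ cong suc (length-++ ys) ⟨
  length (α ∷ ys ++ β ∷ zs) ≡⟨ cong length eq ⟩
  length (vs ++ us)         ≡⟨ ↭-length (++-comm vs us) ⟩
  length (us ++ vs)         ∎
  where
  open Move m
  open ≤-Reasoning

singletons⇒stuck : ∀ {P : Position n} → All Singleton (labelsOf P) → ¬ Move P
singletons⇒stuck ss m with All.lookup (All.map⁻ ss) (Move.region∈P m) | region-length m
... | x , eq | 2≤ with trans (sym (length-map short (Move.region m))) (cong length eq)
... | len rewrite len with 2≤
... | s≤s ()

-- Minimality places the two points of the first factor in one region, which yields a move; that
-- move uses up one factor and adds one region, so minimality persists.
factorization-play : ∀ {P : Position n} (ts : List (Permutation′ n)) → Config π (labelsOf P) →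
  length ts + length P ≡ n → All IsTransposition ts → product ts ⟨$⟩ʳ_ ≗ π →
  ∃[ p ] (transpositions {P = P} p ≋ ts)
factorization-play [] c _ _ eq =
  end (singletons⇒stuck (fixed⇒singletons (sym ∘ eq) (unique c) (cycles c))) , []
factorization-play {π = π} {P = P} (t ∷ ts) c len trs@(_ ∷ trs′) eq
  with minimal⇒together {t = t} {ts} c trs eq
         (trans (cong (suc (length ts) +_) (length-map (map short) P)) len)
... | i , j , t≈ , together with Together⇒move together
... | m , refl , refl with Config-move m c
... | _ , c′ with factorization-play ts c′
                   (trans (+-suc (length ts) _)
                     (trans (cong (λ k → suc (length ts + k)) (sym (↭-length (∈⇒↭─ (Move.region∈P m))))) len))
                   trs′ (product-tail {t = t} {ts} t≈′ eq)
  where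
  t≈′ : t Perm.≈ Move.transposition m
  t≈′ k = trans (t≈ k) (transpose-comm i j k)
... | p , ps = m ▸ p , (λ k → sym (trans (t≈ k) (transpose-comm i j k))) ∷ ps

-- Recovering long labels: equal lines of play and equal sequences.

Arms : (Fin n → Arm n) → Position n → Set
Arms f P = All (All (λ α → f (short α) ≡ α)) P

module _ (f : Fin n → Arm n) (i j : Fin n) where

  -- A short label determines its free arm, so a function of labels can stand for the free arms of a
  -- position; this is its change under a move.
  join : Fin n → Arm n
  join k with k ≟ i | k ≟ j
  ... | yes _ | _     = ⟨ f i , f j ⟩
  ... | no _  | yes _ = ⟨ f j , f i ⟩
  ... | no _  | no _  = f k

  join-left : join i ≡ ⟨ f i , f j ⟩
  join-left with i ≟ i
  ... | yes _ = refl
  ... | no i≢i = contradiction refl i≢i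

  join-right : i ≢ j → join j ≡ ⟨ f j , f i ⟩
  join-right i≢j with j ≟ i | j ≟ j
  ... | yes j≡i | _ = contradiction (sym j≡i) i≢j
  ... | no _ | yes _ = refl
  ... | no _ | no j≢j = contradiction refl j≢j

  join-other : ∀ {k} → k ≢ i → k ≢ j → join k ≡ f k
  join-other {k} k≢i k≢j with k ≟ i | k ≟ j
  ... | yes k≡i | _ = contradiction k≡i k≢i
  ... | no _ | yes k≡j = contradiction k≡j k≢j
  ... | no _ | no _ = refl

-- The joined pair is unordered, so two descriptions of one move must lead to the same record of
-- arms.
join-comm : ∀ (f : Fin n → Arm n) {i j} → i ≢ j → join f i j ≗ join f j i
join-comm f {i} {j} i≢j k with k ≟ i | k ≟ j
... | yes refl | yes refl = contradiction refl i≢j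
... | yes refl | no _ = refl
... | no _ | yes refl = refl
... | no _ | no _ = refl

Arms-cong : ∀ {f g} {P : Position n} → f ≗ g → Arms f P → Arms g P
Arms-cong eq = All.map (All.map (trans (sym (eq _))))

module _ {P : Position n} (m : Move P) (f : Fin n → Arm n) (as : Arms f P) where
  open Move m

  private
    region-arms : All (λ γ → f (short γ) ≡ γ) (α ∷ ys ++ β ∷ zs)
    region-arms with clockwise | All.lookup as region∈P
    ... | us , vs , refl , s≡ | as′ = subst (All _) (sym s≡) (All-resp-↭ (++-comm us vs) as′)

  arm-α : f (short α) ≡ α
  arm-α = All.head region-arms

  arm-β : f (short β) ≡ β
  arm-β = All.head (All.++⁻ʳ ys (All.tail region-arms))

  Arms-move : Config π (labelsOf P) → Arms (join f (short α) (short β)) result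
  Arms-move c with short-distinct m c
  ... | α≢β , fresh-ys , fresh-zs , fresh-rest =
    (trans (join-left f _ _) (cong₂ ⟨_,_⟩ arm-α arm-β) ∷ keep fresh-ys (All.++⁻ˡ ys (All.tail region-arms))) ∷
    (trans (join-right f _ _ α≢β) (cong₂ ⟨_,_⟩ arm-β arm-α) ∷
      keep fresh-zs (All.tail (All.++⁻ʳ ys (All.tail region-arms)))) ∷
    All.zipWith (λ (p , q) → keep p q) (fresh-rest , All.tail (All-resp-↭ (∈⇒↭─ region∈P) as))
    where
    keep : ∀ {xs} → All (λ γ → short γ ≢ short α × short γ ≢ short β) xs →
      All (λ γ → f (short γ) ≡ γ) xs → All (λ γ → join f (short α) (short β) (short γ) ≡ γ) xs
    keep p q = All.zipWith (λ ((≢α , ≢β) , e) → trans (join-other f _ _ ≢α ≢β) e) (p , q)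

Injective : (Fin n → Fin n) → Set
Injective π = ∀ {i j} → π i ≡ π j → i ≡ j

∘-transpose-injective : ∀ (i j : Fin n) → Injective π → Injective (π ∘ PC.transpose i j)
∘-transpose-injective i j inj eq = trans (sym (transpose-involutive i j _))
  (trans (cong (PC.transpose i j) (inj eq)) (transpose-involutive i j _))

-- By uniqueness of short labels, π and the free arms f determine the position up to rotation and
-- order of its regions.
module _ {P Q : Position n} (f : Fin n → Arm n) (inj : Injective π)
         (cP : Config π (labelsOf P)) (cQ : Config π (labelsOf Q)) (aP : Arms f P) (aQ : Arms f Q)
         (m : Move P) (m′ : Move Q) where
  private
    module M = Move m
    module M′ = Move m′

  SameLabels : Set
  SameLabels = (short M.α ≡ short M′.α × short M.β ≡ short M′.β)
             ⊎ (short M.α ≡ short M′.β × short M.β ≡ short M′.α)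

  ≐⇒labels : M.joined ≐ M′.joined → SameLabels
  ≐⇒labels (inj₁ (p , q)) = inj₁ (cong short p , cong short q)
  ≐⇒labels (inj₂ (p , q)) = inj₂ (cong short p , cong short q)

  labels⇒≐ : SameLabels → M.joined ≐ M′.joined
  labels⇒≐ (inj₁ (p , q)) = inj₁
    ( trans (sym (arm-α m f aP)) (trans (cong f p) (arm-α m′ f aQ))
    , trans (sym (arm-β m f aP)) (trans (cong f q) (arm-β m′ f aQ)))
  labels⇒≐ (inj₂ (p , q)) = inj₂
    ( trans (sym (arm-α m f aP)) (trans (cong f p) (arm-β m′ f aQ))
    , trans (sym (arm-β m f aP)) (trans (cong f q) (arm-α m′ f aQ)))

  ≈⇒labels : M.transposition Perm.≈ M′.transposition → SameLabels
  ≈⇒labels eq with transpose-determines (proj₁ (Config-move m cP)) eq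
  ... | inj₁ (p , q) = inj₁
    ( trans (sym (short-ccwα m cP)) (trans (cong π p) (short-ccwα m′ cQ))
    , trans (sym (short-ccwβ m cP)) (trans (cong π q) (short-ccwβ m′ cQ)))
  ... | inj₂ (p , q) = inj₂
    ( trans (sym (short-ccwα m cP)) (trans (cong π p) (short-ccwβ m′ cQ))
    , trans (sym (short-ccwβ m cP)) (trans (cong π q) (short-ccwα m′ cQ)))

  -- The joined labels are the images under `π` of the labels in the transposition, and `π` is
  -- injective.
  labels⇒≈ : SameLabels → M.transposition Perm.≈ M′.transposition
  labels⇒≈ (inj₁ (p , q))
    rewrite inj (trans (short-ccwα m cP) (trans p (sym (short-ccwα m′ cQ))))
          | inj (trans (short-ccwβ m cP) (trans q (sym (short-ccwβ m′ cQ)))) = λ _ → refl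
  labels⇒≈ (inj₂ (p , q))
    rewrite inj (trans (short-ccwα m cP) (trans p (sym (short-ccwβ m′ cQ))))
          | inj (trans (short-ccwβ m cP) (trans q (sym (short-ccwα m′ cQ)))) = transpose-comm _ _

  next-Config : SameLabels →
    Config (π ∘ PC.transpose (short M.ccwα) (short M.ccwβ)) (labelsOf M′.result)
  next-Config same = Config-cong (λ k → cong π (sym (labels⇒≈ same k))) (proj₂ (Config-move m′ cQ))

  next-Arms : SameLabels → Arms (join f (short M.α) (short M.β)) M′.result
  next-Arms (inj₁ (p , q)) rewrite p | q = Arms-move m′ f aQ cQ
  next-Arms (inj₂ (p , q)) rewrite p | q =
    Arms-cong (join-comm f (proj₁ (short-distinct m′ cQ))) (Arms-move m′ f aQ cQ)

-- The positions of the two plays may list their regions differently. What the induction carries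
-- along is that both have the same `π` and the same arms `f`.
joins⇒transpositions : ∀ {P Q : Position n} f (p : Play P) (q : Play Q) → Injective π →
  Config π (labelsOf P) → Config π (labelsOf Q) → Arms f P → Arms f Q →
  Pointwise _≐_ (joins p) (joins q) → transpositions p ≋ transpositions q
joins⇒transpositions f (end _) (end _) inj cP cQ aP aQ [] = []
joins⇒transpositions f (m ▸ p) (m′ ▸ q) inj cP cQ aP aQ (eq ∷ eqs) =
  labels⇒≈ f inj cP cQ aP aQ m m′ same ∷
  joins⇒transpositions (join f (short (Move.α m)) (short (Move.β m))) p q (∘-transpose-injective _ _ inj) (proj₂ (Config-move m cP))
    (next-Config f inj cP cQ aP aQ m m′ same) (Arms-move m f aP cP) (next-Arms f inj cP cQ aP aQ m m′ same) eqs
  where same = ≐⇒labels f inj cP cQ aP aQ m m′ eq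

transpositions⇒joins : ∀ {P Q : Position n} f (p : Play P) (q : Play Q) → Injective π →
  Config π (labelsOf P) → Config π (labelsOf Q) → Arms f P → Arms f Q →
  transpositions p ≋ transpositions q → Pointwise _≐_ (joins p) (joins q)
transpositions⇒joins f (end _) (end _) inj cP cQ aP aQ [] = []
transpositions⇒joins f (m ▸ p) (m′ ▸ q) inj cP cQ aP aQ (eq ∷ eqs) =
  labels⇒≐ f inj cP cQ aP aQ m m′ same ∷
  transpositions⇒joins (join f (short (Move.α m)) (short (Move.β m))) p q (∘-transpose-injective _ _ inj) (proj₂ (Config-move m cP))
    (next-Config f inj cP cQ aP aQ m m′ same) (Arms-move m f aP cP) (next-Arms f inj cP cQ aP aQ m m′ same) eqs
  where same = ≈⇒labels f inj cP cQ aP aQ m m′ eq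

-- Parking functions

weight : (Fin n → ℕ) → List (Fin n) → ℕ
weight w []       = 0
weight w (x ∷ xs) = w x + weight w xs

-- Comparing with the length of the tail is a strict inequality between the weight and the length of
-- every nonempty suffix.
Light : (Fin n → ℕ) → List (Fin n) → Set
Light w []       = ⊤
Light w (x ∷ xs) = weight w (x ∷ xs) ≤ length xs × Light w xs

-- For w x the number of cars preferring x, this is the parking condition, with the last element of
-- the region as the spot that stays empty.
Parking : (Fin n → ℕ) → List (Fin n) → Set
Parking w xs = Light w xs × suc (weight w xs) ≡ length xs

private
  variable
    v w : Fin n → ℕ

weight-++ : ∀ (w : Fin n → ℕ) xs ys → weight w (xs ++ ys) ≡ weight w xs + weight w ys
weight-++ w [] ys = refl
weight-++ w (x ∷ xs) ys = trans (cong (w x +_) (weight-++ w xs ys)) (sym (+-assoc (w x) _ _))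

weight-cong : ∀ {xs} → All (λ x → v x ≡ w x) xs → weight {n} v xs ≡ weight w xs
weight-cong [] = refl
weight-cong (e ∷ es) = cong₂ _+_ e (weight-cong es)

Light-cong : ∀ {xs} → All (λ x → v x ≡ w x) xs → Light {n} v xs → Light w xs
Light-cong [] _ = tt
Light-cong {xs = x ∷ xs} (e ∷ es) (p , q) =
  subst (_≤ length xs) (weight-cong (e ∷ es)) p , Light-cong es q

Parking-cong : ∀ {xs} → All (λ x → v x ≡ w x) xs → Parking {n} v xs → Parking w xs
Parking-cong es (p , q) = Light-cong es p , trans (cong suc (sym (weight-cong es))) q

Light-++⁻ʳ : ∀ xs {ys} → Light {n} w (xs ++ ys) → Light w ys
Light-++⁻ʳ [] p = p
Light-++⁻ʳ (x ∷ xs) (_ , p) = Light-++⁻ʳ xs p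

Light-weight : ∀ {xs} → Light {n} w xs → weight w xs ≤ length xs
Light-weight {xs = []} _ = z≤n
Light-weight {xs = x ∷ xs} (p , _) = ≤-trans p (n≤1+n _)

Light-++⁺ : ∀ xs {ys} → Light {n} w xs → Light w ys → Light w (xs ++ ys)
Light-++⁺ [] _ q = q
Light-++⁺ {w = w} (x ∷ xs) {ys} (e , p) q = bound , Light-++⁺ xs p q
  where
  open ≤-Reasoning
  bound : w x + weight w (xs ++ ys) ≤ length (xs ++ ys)
  bound = begin
    weight w (x ∷ xs ++ ys)           ≡⟨ weight-++ w (x ∷ xs) ys ⟩
    weight w (x ∷ xs) + weight w ys   ≤⟨ +-mono-≤ e (Light-weight q) ⟩
    length xs + length ys             ≡⟨ length-++ xs ⟨
    length (xs ++ ys)                 ∎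

-- Here `v` counts the letters of a word beginning with `a`, and `w` those of the word without this
-- first letter; `C` is the block that the corresponding transposition cuts off behind `a`.
module _ {a : Fin n} {v w : Fin n → ℕ} (at-a : v a ≡ suc (w a))
         (C Z : List (Fin n)) (onC : All (λ x → v x ≡ w x) C) (onZ : All (λ x → v x ≡ w x) Z)
         (total : suc (weight w C) ≡ length C) where

  length-insert : ∀ U → length (U ++ a ∷ C ++ Z) ≡ length (U ++ a ∷ Z) + length C
  length-insert [] = cong suc (trans (length-++ C) (+-comm (length C) _))
  length-insert (u ∷ U) = cong suc (length-insert U)

  -- `C` weighs one less than its length, and the additional letter at `a` supplies the missing
  -- unit. So inserting `C` adds the same amount to weight and length, and the parking inequalities
  -- survive in both directions.
  weight-insert : ∀ U → All (λ x → v x ≡ w x) U →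
    weight v (U ++ a ∷ C ++ Z) ≡ weight w (U ++ a ∷ Z) + length C
  weight-insert [] [] = begin
    v a + weight v (C ++ Z)                ≡⟨ cong₂ _+_ at-a (weight-cong (All.++⁺ onC onZ)) ⟩
    suc (w a) + weight w (C ++ Z)          ≡⟨ cong (suc (w a) +_) (weight-++ w C Z) ⟩
    suc (w a) + (weight w C + weight w Z)  ≡⟨ cong (suc (w a) +_) (+-comm (weight w C) _) ⟩
    suc (w a) + (weight w Z + weight w C)  ≡⟨ +-assoc (suc (w a)) _ _ ⟨
    suc (w a + weight w Z + weight w C)    ≡⟨ +-suc _ _ ⟨
    w a + weight w Z + suc (weight w C)    ≡⟨ cong (w a + weight w Z +_) total ⟩
    w a + weight w Z + length C            ∎
    where open ≡-Reasoning
  weight-insert (u ∷ U) (e ∷ es) =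
    trans (cong₂ _+_ e (weight-insert U es)) (sym (+-assoc (w u) _ _))

  Light-insert : ∀ U → All (λ x → v x ≡ w x) U → Light w (U ++ a ∷ Z) → Light w C →
    Light v (U ++ a ∷ C ++ Z)
  Light-insert [] [] (p , q) l = bound , Light-cong (All.map sym (All.++⁺ onC onZ)) (Light-++⁺ C l q)
    where
    open ≤-Reasoning
    bound = begin
      weight v (a ∷ C ++ Z)         ≡⟨ weight-insert [] [] ⟩
      weight w (a ∷ Z) + length C   ≤⟨ +-monoˡ-≤ (length C) p ⟩
      length Z + length C           ≡⟨ suc-injective (length-insert []) ⟨
      length (C ++ Z)               ∎
  Light-insert (u ∷ U) (e ∷ es) (p , q) l = bound , Light-insert U es q l
    where
    open ≤-Reasoning
    bound = begin
      weight v (u ∷ U ++ a ∷ C ++ Z)         ≡⟨ weight-insert (u ∷ U) (e ∷ es) ⟩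
      weight w (u ∷ U ++ a ∷ Z) + length C   ≤⟨ +-monoˡ-≤ (length C) p ⟩
      length (U ++ a ∷ Z) + length C         ≡⟨ length-insert U ⟨
      length (U ++ a ∷ C ++ Z)               ∎

  Light-remove : ∀ U → All (λ x → v x ≡ w x) U → Light v (U ++ a ∷ C ++ Z) → Light w (U ++ a ∷ Z)
  Light-remove [] [] (p , q) = +-cancelʳ-≤ (length C) _ _ bound ,
    Light-++⁻ʳ C (Light-cong (All.++⁺ onC onZ) q)
    where
    open ≤-Reasoning
    bound = begin
      weight w (a ∷ Z) + length C   ≡⟨ weight-insert [] [] ⟨
      weight v (a ∷ C ++ Z)         ≤⟨ p ⟩
      length (C ++ Z)               ≡⟨ suc-injective (length-insert []) ⟩
      length Z + length C           ∎
  Light-remove (u ∷ U) (e ∷ es) (p , q) = +-cancelʳ-≤ (length C) _ _ bound , Light-remove U es q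
    where
    open ≤-Reasoning
    bound = begin
      weight w (u ∷ U ++ a ∷ Z) + length C   ≡⟨ weight-insert (u ∷ U) (e ∷ es) ⟨
      weight v (u ∷ U ++ a ∷ C ++ Z)         ≤⟨ p ⟩
      length (U ++ a ∷ C ++ Z)               ≡⟨ length-insert U ⟩
      length (U ++ a ∷ Z) + length C         ∎

  Parking-insert : ∀ U → All (λ x → v x ≡ w x) U → Light w C → Parking w (U ++ a ∷ Z) →
    Parking v (U ++ a ∷ C ++ Z)
  Parking-insert U es l (p , q) = Light-insert U es p l ,
    trans (cong suc (weight-insert U es)) (trans (cong (_+ length C) q) (sym (length-insert U)))

  Parking-remove : ∀ U → All (λ x → v x ≡ w x) U → Parking v (U ++ a ∷ C ++ Z) → Parking w (U ++ a ∷ Z)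
  Parking-remove U es (p , q) = Light-remove U es p , +-cancelʳ-≡ (length C) _ _
    (trans (cong suc (sym (weight-insert U es))) (trans q (length-insert U)))

-- The additional credit k makes the statement inductive; it is used with k = 0.
shortest-prefix : ∀ (w : Fin n → ℕ) k V → k + weight w V < length V → ∃ λ W → ∃₂ λ b Z →
  V ≡ W ++ b ∷ Z × Light w (W ∷ʳ b) × length (W ∷ʳ b) ≡ suc (k + weight w (W ∷ʳ b))
shortest-prefix w k (v ∷ V) lt with k + w v in eq
-- Each entry adds its weight to the credit and spends one unit. The prefix ends at the first entry
-- that finds nothing to spend.
shortest-prefix w zero (v ∷ V) lt | zero =
  [] , v , V , refl , (≤-reflexive wv≡0 , tt) , cong suc (sym wv≡0)
  where wv≡0 = trans (+-identityʳ (w v)) eq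
shortest-prefix w k (v ∷ V) (s≤s le) | suc k′ with shortest-prefix w k′ V (begin
    suc k′ + weight w V       ≡⟨ cong (_+ weight w V) eq ⟨
    (k + w v) + weight w V    ≡⟨ +-assoc k (w v) _ ⟩
    k + (w v + weight w V)    ≤⟨ le ⟩
    length V                  ∎)
  where open ≤-Reasoning
... | W , b , Z , refl , light , len =
  v ∷ W , b , Z , refl , (≤-trans (m≤n+m _ k) (≤-reflexive (sym len′)) , light) , cong suc len′
  where
  len′ : length (W ∷ʳ b) ≡ k + (w v + weight w (W ∷ʳ b))
  len′ = trans len (trans (cong (_+ weight w (W ∷ʳ b)) (sym eq)) (+-assoc k (w v) _))

-- Both lists have weight one below their length, so the part by which they differ would weigh
-- exactly its length, although as a suffix it must weigh less.
Parking-not-extended : ∀ {xs y ys} → Parking {n} w xs → ¬ Parking w (xs ++ y ∷ ys)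
Parking-not-extended {w = w} {xs} {y} {ys} (_ , q) (l , q′) with Light-++⁻ʳ xs l
... | (p , _) = 1+n≰n (≤-trans (≤-reflexive (sym too-heavy)) p)
  where
  open ≡-Reasoning
  too-heavy : weight w (y ∷ ys) ≡ suc (length ys)
  too-heavy = +-cancelˡ-≡ (length xs) _ _ (begin
    length xs + weight w (y ∷ ys)          ≡⟨ cong (_+ weight w (y ∷ ys)) q ⟨
    suc (weight w xs + weight w (y ∷ ys))  ≡⟨ cong suc (weight-++ w xs (y ∷ ys)) ⟨
    suc (weight w (xs ++ y ∷ ys))          ≡⟨ q′ ⟩
    length (xs ++ y ∷ ys)                  ≡⟨ length-++ xs ⟩
    length xs + suc (length ys)            ∎)

prefixes-comparable : ∀ (xs xs′ : List A) {ys ys′} → xs ++ ys ≡ xs′ ++ ys′ →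
  xs ≡ xs′ ⊎ (∃₂ λ z zs → xs′ ≡ xs ++ z ∷ zs) ⊎ (∃₂ λ z zs → xs ≡ xs′ ++ z ∷ zs)
prefixes-comparable [] [] eq = inj₁ refl
prefixes-comparable [] (x ∷ xs′) eq = inj₂ (inj₁ (x , xs′ , refl))
prefixes-comparable (x ∷ xs) [] eq = inj₂ (inj₂ (x , xs , refl))
prefixes-comparable (x ∷ xs) (x′ ∷ xs′) eq with ∷-injectiveˡ eq | prefixes-comparable xs xs′ (∷-injectiveʳ eq)
... | refl | inj₁ refl = inj₁ refl
... | refl | inj₂ (inj₁ (z , zs , refl)) = inj₂ (inj₁ (z , zs , refl))
... | refl | inj₂ (inj₂ (z , zs , refl)) = inj₂ (inj₂ (z , zs , refl))

-- This determines `b`: the block `W ∷ʳ b` can only be the one parking prefix of what follows `a`.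
Parking-prefix-unique : ∀ {xs xs′ ys ys′} → Parking {n} w xs → Parking w xs′ →
  xs ++ ys ≡ xs′ ++ ys′ → xs ≡ xs′
Parking-prefix-unique {xs = xs} {xs′} p p′ eq with prefixes-comparable xs xs′ eq
... | inj₁ xs≡xs′ = xs≡xs′
... | inj₂ (inj₁ (_ , _ , refl)) = contradiction p′ (Parking-not-extended p)
... | inj₂ (inj₂ (_ , _ , refl)) = contradiction p (Parking-not-extended p′)

-- Factorizations recorded by parking functions.

occurrences : List (Fin n) → Fin n → ℕ
occurrences []      x = 0
occurrences (a ∷ s) x with x ≟ a
... | yes _ = suc (occurrences s x)
... | no  _ = occurrences s x

weight-[] : ∀ (xs : List (Fin n)) → weight (occurrences []) xs ≡ 0
weight-[] [] = refl
weight-[] (x ∷ xs) = weight-[] xs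

occurrences-same : ∀ (a : Fin n) s → occurrences (a ∷ s) a ≡ suc (occurrences s a)
occurrences-same a s with a ≟ a
... | yes _ = refl
... | no a≢a = contradiction refl a≢a

occurrences-other : ∀ {a : Fin n} s {x} → a ≢ x → occurrences (a ∷ s) x ≡ occurrences s x
occurrences-other {a = a} s {x} a≢x with x ≟ a
... | yes x≡a = contradiction (sym x≡a) a≢x
... | no _ = refl

-- A region is read in the linear order inherited from 1 < ⋯ < n, and a transposition (a b) with a
-- before b is recorded by a.
data Encodes {n} (P : LabelPosition n) : List (Permutation′ n) → List (Fin n) → Set where
  done : All Singleton P → Encodes P [] []
  step : ∀ {t ts s} U a W b Z {Q} → P ↭ (U ++ a ∷ W ++ b ∷ Z) ∷ Q → t Perm.≈ transpose a b →
    Encodes ((U ++ a ∷ Z) ∷ (W ∷ʳ b) ∷ Q) ts s → Encodes P (t ∷ ts) (a ∷ s)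

factorization⇒Encodes : ∀ (ts : List (Permutation′ n)) {P} → Config π P → All IsTransposition ts →
  length ts + length P ≡ n → product ts ⟨$⟩ʳ_ ≗ π → ∃ λ s → Encodes P ts s
factorization⇒Encodes [] c _ _ eq = [] , done (fixed⇒singletons (sym ∘ eq) (unique c) (cycles c))
factorization⇒Encodes (t ∷ ts) c trs@(_ ∷ trs′) len eq with minimal⇒together {t = t} {ts} c trs eq len
... | a , b , t≈ , U , W , Z , X∈P with extract X∈P
... | Q , P↭ with factorization⇒Encodes ts (Config-split U a W b Z (Config-↭ P↭ c)) trs′
                    (trans (+-suc (length ts) _) (trans (cong (suc (length ts) +_) (sym (↭-length P↭))) len))
                    (product-tail {t = t} {ts} t≈ eq)
... | s , e = a ∷ s , step U a W b Z P↭ t≈ e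

label-fresh : ∀ U {a : Fin n} {V Q} → Config π ((U ++ a ∷ V) ∷ Q) →
  All (a ≢_) U × All (a ≢_) V × All (All (a ≢_)) Q
label-fresh U {a} {V} {Q} c with Unique-resp-↭ (++⁺ʳ (concat Q) (shift a U V)) (unique c)
... | a≢ ∷ _ with All.++⁻ (U ++ V) a≢
... | a≢UV , a≢Q with All.++⁻ U a≢UV
... | a≢U , a≢V = a≢U , a≢V , All.concat⁻ a≢Q

Encodes⇒factorization : ∀ {P : LabelPosition n} {ts s} → Encodes P ts s → Config π P →
  length ts + length P ≡ n × All IsTransposition ts × product ts ⟨$⟩ʳ_ ≗ π
Encodes⇒factorization (done ss) c =
  trans (sym (length-concat-singletons ss)) (Config-length c) , [] , sym ∘ singletons⇒fixed c ss
Encodes⇒factorization {π = π} {ts = t ∷ ts} (step U a W b Z P↭ t≈ e) c =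
  let c₀ = Config-↭ P↭ c
      len , trs , eq = Encodes⇒factorization e (Config-split U a W b Z c₀)
      _ , a≢V , _ = label-fresh U c₀
  in trans (cong (suc (length ts) +_) (↭-length P↭)) (trans (sym (+-suc (length ts) _)) len) ,
     (a , b , All.lookup a≢V (∈-insert W) , t≈) ∷ trs ,
     λ k → trans (eq _) (cong π (trans (cong (PC.transpose a b) (t≈ k)) (transpose-involutive a b k)))

Encodes⇒length : ∀ {P : LabelPosition n} {ts s} → Encodes P ts s → length ts ≡ length s
Encodes⇒length (done _) = refl
Encodes⇒length (step _ _ _ _ _ _ _ e) = cong suc (Encodes⇒length e)

-- Read backwards from the singletons, each step puts a block back behind `a` and restores one
-- letter `a`, which fills the block's deficit of one.
Encodes⇒Parking : ∀ {P : LabelPosition n} {ts s} → Encodes P ts s → Config π P →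
  All (Parking (occurrences s)) P
Encodes⇒Parking (done ss) c = All.map (λ { (x , refl) → (z≤n , tt) , refl }) ss
Encodes⇒Parking {s = a ∷ s} (step U a W b Z {Q} P↭ t≈ e) c
  with label-fresh U (Config-↭ P↭ c) | Encodes⇒Parking e (Config-split U a W b Z (Config-↭ P↭ c))
... | a≢U , a≢V , a≢Q | p ∷ (l , total) ∷ ps =
  All-resp-↭ (↭-sym P↭)
    (subst (λ V → Parking (occurrences (a ∷ s)) (U ++ a ∷ V)) (++-assoc W [ b ] Z)
      (Parking-insert (occurrences-same a s) (W ∷ʳ b) Z (fresh (All.++⁻ˡ (W ∷ʳ b) a≢V′))
        (fresh (All.++⁻ʳ (W ∷ʳ b) a≢V′)) total U (fresh a≢U) l p) ∷
    All.zipWith (λ (q , r) → Parking-cong (All.map sym (fresh q)) r) (a≢Q , ps))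
  where
  a≢V′ = subst (All (a ≢_)) (sym (++-assoc W [ b ] Z)) a≢V
  fresh : ∀ {xs} → All (a ≢_) xs → All (λ x → occurrences (a ∷ s) x ≡ occurrences s x) xs
  fresh = All.map (occurrences-other s)

-- The suffix beginning at `a` is light. Without its first letter `a`, the word therefore gives the
-- part behind `a` a weight strictly below its length, so a shortest parking prefix exists there,
-- and its last entry serves as `b`.
Parking⇒Encodes : ∀ {P : LabelPosition n} s → Config π P → All (Parking (occurrences s)) P →
  ∃ λ ts → Encodes P ts s
Parking⇒Encodes [] c ps = [] , done (All.map (λ {xs} → single xs) ps)
  where
  single : ∀ xs → Parking (occurrences []) xs → Singleton xs
  single (x ∷ []) _ = x , refl
  single (x ∷ y ∷ xs) (_ , q) with trans (cong suc (sym (weight-[] xs))) q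
  ... | ()
Parking⇒Encodes {P = P} (a ∷ s) c ps with ∈-concat⁻′ P (covers c a)
... | X , a∈X , X∈P with extract X∈P | ∈-∃++ a∈X
... | Q , P↭ | U , V , refl with label-fresh U (Config-↭ P↭ c) | All-resp-↭ P↭ ps
... | a≢U , a≢V , a≢Q | p ∷ ps′ with shortest-prefix (occurrences s) 0 V (begin
    suc (weight (occurrences s) V)  ≤⟨ s≤s (m≤n+m _ (occurrences s a)) ⟩
    suc (occurrences s a) + weight (occurrences s) V
      ≡⟨ cong₂ _+_ (occurrences-same a s) (weight-cong (All.map (occurrences-other s) a≢V)) ⟨
    weight (occurrences (a ∷ s)) (a ∷ V) ≤⟨ proj₁ (Light-++⁻ʳ U (proj₁ p)) ⟩
    length V ∎)
  where open ≤-Reasoning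
... | W , b , Z , refl , l , total =
  let ts , e = Parking⇒Encodes s (Config-split U a W b Z (Config-↭ P↭ c))
        (Parking-remove (occurrences-same a s) (W ∷ʳ b) Z (fresh (All.++⁻ˡ (W ∷ʳ b) a≢V′))
           (fresh (All.++⁻ʳ (W ∷ʳ b) a≢V′)) (sym total) U (fresh a≢U)
           (subst (λ V → Parking (occurrences (a ∷ s)) (U ++ a ∷ V)) (sym (++-assoc W [ b ] Z)) p) ∷
         (l , sym total) ∷
         All.zipWith (λ (q , r) → Parking-cong (fresh q) r) (a≢Q , ps′))
  in transpose a b ∷ ts , step U a W b Z P↭ (λ _ → refl) e
  where
  a≢V′ = subst (All (a ≢_)) (sym (++-assoc W [ b ] Z)) a≢V
  fresh : ∀ {xs} → All (a ≢_) xs → All (λ x → occurrences (a ∷ s) x ≡ occurrences s x) xs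
  fresh = All.map (occurrences-other s)

split-unique : ∀ {a : A} U U′ {V V′} → All (a ≢_) U → All (a ≢_) U′ → U ++ a ∷ V ≡ U′ ++ a ∷ V′ →
  U ≡ U′ × V ≡ V′
split-unique [] [] _ _ refl = refl , refl
split-unique [] (_ ∷ U′) _ (a≢u ∷ _) eq = contradiction (∷-injectiveˡ eq) a≢u
split-unique (_ ∷ U) [] (a≢u ∷ _) _ eq = contradiction (sym (∷-injectiveˡ eq)) a≢u
split-unique (_ ∷ U) (_ ∷ U′) (_ ∷ p) (_ ∷ p′) eq with ∷-injectiveˡ eq | split-unique U U′ p p′ (∷-injectiveʳ eq)
... | refl | refl , refl = refl , refl

same-region : ∀ U {a : Fin n} {V Q X′ Q′} → Config π ((U ++ a ∷ V) ∷ Q) → (U ++ a ∷ V) ∷ Q ↭ X′ ∷ Q′ →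
  a ∈ X′ → X′ ≡ U ++ a ∷ V × Q ↭ Q′
same-region U c eq a∈X′ with ∈-resp-↭ (↭-sym eq) (here refl)
... | here refl = refl , drop-∷ eq
... | there X′∈Q = contradiction refl
  (All.lookup (All.lookup (proj₂ (proj₂ (label-fresh U c))) X′∈Q) a∈X′)

-- The letter `a` determines its region and its place there, and the rest of the word determines the
-- block behind it, hence `b`.
Encodes-functional : ∀ {P P′ : LabelPosition n} {ts us s} → Encodes P ts s → Encodes P′ us s →
  P ↭ P′ → Config π P → ts ≋ us
Encodes-functional (done _) (done _) _ _ = []
Encodes-functional (step U a W b Z P↭ t≈ e) (step U′ a W′ b′ Z′ P′↭ u≈ e′) P↭P′ c
  with same-region U (Config-↭ P↭ c) (↭-trans (↭-sym P↭) (↭-trans P↭P′ P′↭)) (∈-insert U′)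
... | X≡ , Q↭ with split-unique U′ U (proj₁ (label-fresh U′ c₀′)) (proj₁ (label-fresh U c₀)) X≡
  where
  c₀ = Config-↭ P↭ c
  c₀′ = Config-↭ P′↭ (Config-↭ P↭P′ c)
... | refl , V≡ with Parking-prefix-unique
                      (All.head (All.tail (Encodes⇒Parking e (Config-split U a W b Z (Config-↭ P↭ c)))))
                      (All.head (All.tail (Encodes⇒Parking e′
                        (Config-split U a W′ b′ Z′ (Config-↭ P′↭ (Config-↭ P↭P′ c))))))
                      (trans (++-assoc W [ b ] Z) (trans (sym V≡) (sym (++-assoc W′ [ b′ ] Z′))))
... | Wb≡ with ∷ʳ-injective W W′ Wb≡
... | refl , refl with ++-cancelˡ W _ _ V≡
... | refl = (λ k → trans (t≈ k) (sym (u≈ k))) ∷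
  Encodes-functional e e′ (↭-prep _ (↭-prep _ Q↭)) (Config-split U a W b Z (Config-↭ P↭ c))

-- A transposition is an unordered pair, but only the point that comes first in the region can be
-- the recorded one.
Encodes-injective : ∀ {P P′ : LabelPosition n} {ts us s s′} → Encodes P ts s → Encodes P′ us s′ →
  P ↭ P′ → Config π P → ts ≋ us → s ≡ s′
Encodes-injective (done _) (done _) _ _ _ = refl
Encodes-injective {n = n} {π = π} (step U a W b Z {Q} P↭ t≈ e) (step U′ a′ W′ b′ Z′ {Q′} P′↭ u≈ e′) P↭P′ c (eq ∷ eqs)
  = go (transpose-determines (All.lookup (proj₁ (proj₂ (label-fresh U c₀))) (∈-insert W))
         (λ k → trans (sym (t≈ k)) (trans (eq k) (u≈ k)))) e′
  where
  c₀ = Config-↭ P↭ c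
  c₀′ = Config-↭ P′↭ (Config-↭ P↭P′ c)
  X↭ = ↭-trans (↭-sym P↭) (↭-trans P↭P′ P′↭)
  second : ∀ U a W b Z {Q : LabelPosition n} → Config π ((U ++ a ∷ W ++ b ∷ Z) ∷ Q) →
    All (b ≢_) (U ++ a ∷ W)
  second U a W b Z c = proj₁ (label-fresh (U ++ a ∷ W)
    (subst (λ X → Config π (X ∷ _)) (sym (++-assoc U (a ∷ W) (b ∷ Z))) c))
  go : (a ≡ a′ × b ≡ b′) ⊎ (a ≡ b′ × b ≡ a′) →
    Encodes ((U′ ++ a′ ∷ Z′) ∷ (W′ ∷ʳ b′) ∷ Q′) _ _ → _
  go (inj₁ (refl , refl)) e′ with same-region U c₀ X↭ (∈-insert U′)
  ... | X≡ , Q↭ with split-unique U′ U (proj₁ (label-fresh U′ c₀′)) (proj₁ (label-fresh U c₀)) X≡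
  ... | refl , V≡ with split-unique W′ W (All.tail (All.++⁻ʳ U (second U a W′ b Z′ c₀′)))
                         (All.tail (All.++⁻ʳ U (second U a W b Z c₀))) V≡
  ... | refl , refl = cong (a ∷_)
    (Encodes-injective e e′ (↭-prep _ (↭-prep _ Q↭)) (Config-split U a W b Z c₀) eqs)
  -- The crossed matching would put `b` before `a` as well as after it in the same region.
  go (inj₂ (refl , refl)) e′ with same-region U c₀ X↭ (∈-++⁺ʳ U′ (there (∈-insert W′)))
  ... | X≡ , _ with split-unique (U′ ++ b ∷ W′) U (second U′ b W′ a Z′ c₀′) (proj₁ (label-fresh U c₀))
                      (trans (++-assoc U′ (b ∷ W′) (a ∷ Z′)) X≡)
  ... | refl , _ = contradiction refl
    (All.lookup (second (U′ ++ b ∷ W′) a W b Z c₀) (∈-++⁺ˡ (∈-insert U′)))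

-- The cyclic symmetry

tabulate-∷ʳ : ∀ m (f : Fin (suc m) → A) → tabulate f ≡ tabulate (f ∘ inject₁) ∷ʳ f (fromℕ m)
tabulate-∷ʳ zero f = refl
tabulate-∷ʳ (suc m) f = cong (f zero ∷_) (tabulate-∷ʳ m (f ∘ suc))

longCycle-inject₁ : ∀ {m} (i : Fin m) → longCycle (inject₁ i) ≡ suc i
longCycle-inject₁ {m} i = toℕ-injective (begin
  toℕ (longCycle (inject₁ i))            ≡⟨ toℕ-fromℕ< _ ⟩
  suc (toℕ (inject₁ i)) % suc m          ≡⟨ cong (λ k → suc k % suc m) (toℕ-inject₁ i) ⟩
  suc (toℕ i) % suc m                    ≡⟨ m<n⇒m%n≡m (s≤s (toℕ<n i)) ⟩
  suc (toℕ i)                            ∎)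
  where open ≡-Reasoning

longCycle-fromℕ : ∀ m → longCycle (fromℕ m) ≡ zero
longCycle-fromℕ m = toℕ-injective (begin
  toℕ (longCycle (fromℕ m))              ≡⟨ toℕ-fromℕ< _ ⟩
  suc (toℕ (fromℕ m)) % suc m            ≡⟨ cong (λ k → suc k % suc m) (toℕ-fromℕ m) ⟩
  suc m % suc m                          ≡⟨ n%n≡0 (suc m) ⟩
  0                                      ∎)
  where open ≡-Reasoning

map-longCycle : ∀ m → map longCycle (allFin (suc m)) ≡ tabulate suc ∷ʳ zero
map-longCycle m = begin
  map longCycle (allFin (suc m))                                       ≡⟨ map-tabulate id longCycle ⟩
  tabulate longCycle                                                   ≡⟨ tabulate-∷ʳ m longCycle ⟩
  tabulate (longCycle ∘ inject₁) ∷ʳ longCycle (fromℕ m)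
    ≡⟨ cong₂ _∷ʳ_ (tabulate-cong longCycle-inject₁) (longCycle-fromℕ m) ⟩
  tabulate suc ∷ʳ zero                                                 ∎
  where open ≡-Reasoning

map-∷ʳ⇒Path : ∀ xs {x w : Fin n} → map π (x ∷ xs) ≡ xs ∷ʳ w → Path π (x ∷ xs) w
map-∷ʳ⇒Path [] eq = ∷-injectiveˡ eq , tt
map-∷ʳ⇒Path (y ∷ xs) eq = ∷-injectiveˡ eq , map-∷ʳ⇒Path xs (∷-injectiveʳ eq)

Config-longCycle : ∀ m → Config longCycle [ allFin (suc m) ]
Config-longCycle m = config (↭-reflexive (++-identityʳ _))
  (((λ ()) , λ _ → map-∷ʳ⇒Path (tabulate suc) (map-longCycle m)) ∷ [])

turn : ℕ → Fin n → Fin n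
turn zero    i = i
turn (suc d) i = turn d (longCycle i)

turn-+ : ∀ d e (i : Fin n) → turn (d + e) i ≡ turn e (turn d i)
turn-+ zero e i = refl
turn-+ (suc d) e i = turn-+ d e (longCycle i)

turn-comm : ∀ d e (i : Fin n) → turn d (turn e i) ≡ turn e (turn d i)
turn-comm d e i = trans (sym (turn-+ e d i)) (trans (cong (λ k → turn k i) (+-comm e d)) (turn-+ d e i))

map-agree : ∀ {f g : A → A} {xs x} → map f xs ≡ map g xs → x ∈ xs → f x ≡ g x
map-agree eq (here refl) = ∷-injectiveˡ eq
map-agree eq (there x∈xs) = map-agree (∷-injectiveʳ eq) x∈xs

map≡self⇒id : ∀ {f : Fin n → Fin n} → map f (allFin n) ≡ allFin n → f ≗ id
map≡self⇒id eq i = map-agree (trans eq (sym (map-id _))) (∈-allFin i)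

module _ {m : ℕ} where
  private
    X : List (Fin (suc m))
    X = allFin (suc m)

  turn-suc : ∀ d {x xs} → map (turn d) X ≡ x ∷ xs → map (turn (suc d)) X ≡ xs ∷ʳ x
  turn-suc d {x} {xs} eq = begin
    map (turn (suc d)) X                        ≡⟨ map-∘ X ⟩
    map (turn d) (map longCycle X)              ≡⟨ cong (map (turn d)) (map-longCycle m) ⟩
    map (turn d) (tabulate suc ∷ʳ zero)         ≡⟨ map-++ (turn d) (tabulate suc) [ zero ] ⟩
    map (turn d) (tabulate suc) ∷ʳ turn d zero  ≡⟨ cong₂ _∷ʳ_ (∷-injectiveʳ eq) (∷-injectiveˡ eq) ⟩
    xs ∷ʳ x                                     ∎
    where open ≡-Reasoning

  turn-++ : ∀ d U {V} → map (turn d) X ≡ U ++ V → map (turn (length U + d)) X ≡ V ++ U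
  turn-++ d [] {V} eq = trans eq (sym (++-identityʳ V))
  turn-++ d (u ∷ U) {V} eq = begin
    map (turn (suc (length U + d))) X  ≡⟨ cong (λ k → map (turn k) X) (+-suc (length U) d) ⟨
    map (turn (length U + suc d)) X    ≡⟨ turn-++ (suc d) U (trans (turn-suc d eq) (++-assoc U V [ u ])) ⟩
    (V ∷ʳ u) ++ U                      ≡⟨ ++-assoc V [ u ] U ⟩
    V ++ u ∷ U                         ∎
    where open ≡-Reasoning

  turn-rotates : ∀ d → ∃₂ λ U V → X ≡ U ++ V × map (turn d) X ≡ V ++ U
  turn-rotates zero = [] , X , refl , trans (map-id X) (sym (++-identityʳ X))
  turn-rotates (suc d) with turn-rotates d
  ... | U , x ∷ V , eq , eq′ =
    U ∷ʳ x , V , trans eq (sym (++-assoc U [ x ] V)) , trans (turn-suc d eq′) (++-assoc V U [ x ])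
  -- Here `d` has just completed a full turn, so the next step starts over.
  ... | U , [] , eq , eq′ =
    [ zero ] , tabulate suc , refl , turn-suc d (trans eq′ (trans (sym (++-identityʳ U)) (sym eq)))

  -- As many further steps as `V` has entries complete a full turn.
  turn-inverse : ∀ d → ∃ λ e → ∀ (i : Fin (suc m)) → turn e (turn d i) ≡ i
  turn-inverse d with turn-rotates d
  ... | U , V , eq , eq′ = length V , λ i → trans (sym (turn-+ d (length V) i))
    (trans (cong (λ k → turn k i) (+-comm d (length V)))
      (map≡self⇒id (trans (turn-++ d V eq′) (sym eq)) i))

  turn-injective : ∀ d → Injective (turn {suc m} d)
  turn-injective d eq =
    let e , inv = turn-inverse d in trans (sym (inv _)) (trans (cong (turn e) eq) (inv _))

  turn-from-zero : ∀ (i : Fin (suc m)) → ∃ λ d → turn d zero ≡ i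
  turn-from-zero i with ∈-∃++ (∈-allFin i)
  ... | U , V , eq = length U + 0 , ∷-injectiveˡ (turn-++ 0 U (trans (map-id X) eq))

  turn-to-zero : ∀ (i : Fin (suc m)) → ∃ λ d → turn d i ≡ zero
  turn-to-zero i with turn-from-zero i
  ... | d , refl = let e , inv = turn-inverse d in e , inv zero

  -- Every label is a turn of `zero`, and turns commute, so the image of `zero` decides the whole
  -- turn.
  turn-agree : ∀ d e → turn d zero ≡ turn e (zero {m}) → turn d ≗ turn {suc m} e
  turn-agree d e eq i with turn-from-zero i
  ... | k , refl = trans (turn-comm d k zero) (trans (cong (turn k) eq) (turn-comm k e zero))

longCycle-injective : ∀ {m} → Injective (longCycle {suc m})
longCycle-injective = turn-injective 1

-- Pollak's argument: every sequence of n − 1 labels has exactly one parking rotation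

occurrences-map : ∀ {f : Fin n → Fin n} → Injective f → ∀ s x → occurrences (map f s) (f x) ≡ occurrences s x
occurrences-map inj [] x = refl
occurrences-map {f = f} inj (a ∷ s) x with x ≟ a | f x ≟ f a
... | yes _ | yes _ = cong suc (occurrences-map inj s x)
... | yes refl | no ne = contradiction refl ne
... | no x≢a | yes eq = contradiction (inj eq) x≢a
... | no _ | no _ = occurrences-map inj s x

weight-map : ∀ {f : Fin n → Fin n} → (∀ x → v (f x) ≡ w x) → ∀ xs → weight v (map f xs) ≡ weight w xs
weight-map eq [] = refl
weight-map eq (x ∷ xs) = cong₂ _+_ (eq x) (weight-map eq xs)

Light-map : ∀ {f : Fin n → Fin n} → (∀ x → v (f x) ≡ w x) → ∀ xs → Light w xs → Light v (map f xs)
Light-map eq [] _ = tt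
Light-map {f = f} eq (x ∷ xs) (p , q) =
  ≤-trans (≤-reflexive (weight-map eq (x ∷ xs))) (≤-trans p (≤-reflexive (sym (length-map f xs)))) ,
  Light-map eq xs q

Parking-map : ∀ {f : Fin n → Fin n} {xs} → Injective f → ∀ s → Parking (occurrences s) xs →
  Parking (occurrences (map f s)) (map f xs)
Parking-map {f = f} {xs} inj s (p , q) = Light-map (occurrences-map inj s) xs p ,
  trans (cong suc (weight-map (occurrences-map inj s) xs)) (trans q (sym (length-map f xs)))

-- Each of the two pieces is a suffix of one of the rotations and hence weighs less than its length.
-- Together they fall two short of the total length, whereas a parking list falls only one short.
Parking-rotation-trivial : ∀ {u : Fin n} {U y V} → Parking w ((u ∷ U) ++ y ∷ V) →
  ¬ Parking w ((y ∷ V) ++ u ∷ U)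
Parking-rotation-trivial {w = w} {u} {U} {y} {V} (l , total) (l′ , _) = 1+n≰n (begin
  suc (suc (length U + length V))                     ≡⟨ cong suc (+-suc (length U) (length V)) ⟨
  suc (length U + length (y ∷ V))                     ≡⟨ length-++ (u ∷ U) ⟨
  length ((u ∷ U) ++ y ∷ V)                           ≡⟨ total ⟨
  suc (weight w ((u ∷ U) ++ y ∷ V))                   ≡⟨ cong suc (weight-++ w (u ∷ U) (y ∷ V)) ⟩
  suc (weight w (u ∷ U) + weight w (y ∷ V))
    ≤⟨ s≤s (+-mono-≤ (proj₁ (Light-++⁻ʳ (y ∷ V) l′)) (proj₁ (Light-++⁻ʳ (u ∷ U) l))) ⟩
  suc (length U + length V)                           ∎)
  where open ≤-Reasoning

-- Turning word and circle together preserves parking. The turned word would then park from two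
-- starting points of the circle, unless the turn is trivial.
parking-turn-unique : ∀ {m} d s → Parking (occurrences s) (allFin (suc m)) →
  Parking (occurrences (map (turn d) s)) (allFin (suc m)) → turn d ≗ id
parking-turn-unique {m} d s p p′ with turn-rotates {m} d
... | [] , V , eq , eq′ = map≡self⇒id (trans eq′ (trans (++-identityʳ V) (sym eq)))
... | u ∷ U , [] , eq , eq′ = map≡self⇒id (trans eq′ (trans (sym (++-identityʳ (u ∷ U))) (sym eq)))
... | u ∷ U , y ∷ V , eq , eq′ = contradiction
  (subst (Parking (occurrences (map (turn d) s))) eq′ (Parking-map (turn-injective d) s p))
  (Parking-rotation-trivial (subst (Parking (occurrences (map (turn d) s))) eq p′))

Heavy : (Fin n → ℕ) → List (Fin n) → Set
Heavy w xs = ∀ T {Y} → xs ≡ T ++ Y → length T ≤ weight w T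

-- The list is scanned from the right; as soon as the light part becomes too heavy, it is absorbed
-- by the heavy part and a new light part begins.
light-heavy : ∀ (w : Fin n → ℕ) xs → ∃₂ λ U V → xs ≡ U ++ V × Light w U × Heavy w V
light-heavy w [] = [] , [] , refl , tt , λ { [] _ → z≤n }
light-heavy w (x ∷ xs) with light-heavy w xs
... | U , V , refl , light , heavy with weight w (x ∷ U) ≤? length U
...   | yes p = x ∷ U , V , refl , (p , light) , heavy
...   | no ¬p = [] , x ∷ U ++ V , refl , tt , heavy′
  where
  xU-heavy : length (x ∷ U) ≤ weight w (x ∷ U)
  xU-heavy = ≰⇒> ¬p
  heavy′ : Heavy w ((x ∷ U) ++ V)
  heavy′ [] eq = z≤n
  heavy′ T@(_ ∷ _) eq with prefixes-comparable (x ∷ U) T eq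
  ... | inj₁ refl = xU-heavy
  ... | inj₂ (inj₁ (z , zs , refl)) = begin
    length ((x ∷ U) ++ z ∷ zs)                 ≡⟨ length-++ (x ∷ U) ⟩
    length (x ∷ U) + length (z ∷ zs)
      ≤⟨ +-mono-≤ xU-heavy (heavy (z ∷ zs) (++-cancelˡ (x ∷ U) _ _ (trans eq (++-assoc (x ∷ U) (z ∷ zs) _)))) ⟩
    weight w (x ∷ U) + weight w (z ∷ zs)       ≡⟨ weight-++ w (x ∷ U) (z ∷ zs) ⟨
    weight w ((x ∷ U) ++ z ∷ zs)               ∎
    where open ≤-Reasoning
  -- The prefix ends inside `x ∷ U`. What remains of `U` is light and cannot account for the excess,
  -- so the prefix must.
  heavy′ (t ∷ T) eq | inj₂ (inj₂ (z , zs , refl)) = +-cancelʳ-≤ (length (z ∷ zs)) _ _ (begin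
    length (t ∷ T) + length (z ∷ zs)           ≡⟨ length-++ (t ∷ T) ⟨
    length (t ∷ T ++ z ∷ zs)                   ≤⟨ xU-heavy ⟩
    weight w (t ∷ T ++ z ∷ zs)                 ≡⟨ weight-++ w (t ∷ T) (z ∷ zs) ⟩
    weight w (t ∷ T) + weight w (z ∷ zs)
      ≤⟨ +-monoʳ-≤ (weight w (t ∷ T)) (Light-weight (Light-++⁻ʳ T light)) ⟩
    weight w (t ∷ T) + length (z ∷ zs)         ∎)
    where open ≤-Reasoning

-- Split xs into U, whose nonempty suffixes weigh less than their length, and V, whose prefixes do
-- not; the rotation that starts with V is parking.
parking-rotation : ∀ (w : Fin n → ℕ) xs → suc (weight w xs) ≡ length xs →
  ∃₂ λ U V → xs ≡ U ++ V × Parking w (V ++ U)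
parking-rotation w xs total with light-heavy w xs
... | U , V , refl , light , heavy = U , V , refl , go [] V refl ,
  trans (cong suc (trans (weight-++ w V U) (trans (+-comm (weight w V) _) (sym (weight-++ w U V)))))
    (trans total (↭-length (++-comm U V)))
  where
  go : ∀ T Y → V ≡ T ++ Y → Light w (Y ++ U)
  go T [] eq = light
  go T (y ∷ Y) eq = bound , go (T ∷ʳ y) Y (trans eq (sym (++-assoc T [ y ] Y)))
    where
    open ≤-Reasoning
    -- The complement of this suffix is the prefix `T` of `V`, which weighs at least its length;
    -- subtracting it from the total bounds the suffix.
    bound : weight w (y ∷ Y ++ U) ≤ length (Y ++ U)
    bound = +-cancelˡ-≤ (suc (length T)) _ _ (begin
      suc (length T + weight w (y ∷ Y ++ U))      ≤⟨ s≤s (+-monoˡ-≤ _ (heavy T eq)) ⟩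
      suc (weight w T + weight w (y ∷ Y ++ U))    ≡⟨ cong suc (weight-++ w T _) ⟨
      suc (weight w (T ++ y ∷ Y ++ U))            ≡⟨ cong (suc ∘ weight w) (++-assoc T (y ∷ Y) U) ⟨
      suc (weight w ((T ++ y ∷ Y) ++ U))          ≡⟨ cong (λ V → suc (weight w (V ++ U))) eq ⟨
      suc (weight w (V ++ U))                     ≡⟨ cong suc (weight-++ w V U) ⟩
      suc (weight w V + weight w U)               ≡⟨ cong suc (+-comm (weight w V) _) ⟩
      suc (weight w U + weight w V)               ≡⟨ cong suc (weight-++ w U V) ⟨
      suc (weight w (U ++ V))                     ≡⟨ total ⟩
      length (U ++ V)                             ≡⟨ ↭-length (++-comm U V) ⟩
      length (V ++ U)                             ≡⟨ cong (λ V → length (V ++ U)) eq ⟩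
      length ((T ++ y ∷ Y) ++ U)                  ≡⟨ cong length (++-assoc T (y ∷ Y) U) ⟩
      length (T ++ y ∷ Y ++ U)                    ≡⟨ length-++ T ⟩
      length T + suc (length (Y ++ U))            ≡⟨ +-suc (length T) _ ⟩
      suc (length T + length (Y ++ U))            ∎)

weight-∷ : ∀ {a : Fin n} {s xs} → Unique xs → a ∈ xs →
  weight (occurrences (a ∷ s)) xs ≡ suc (weight (occurrences s) xs)
weight-∷ {a = a} {s} (a≢xs ∷ _) (here refl) =
  cong₂ _+_ (occurrences-same a s) (weight-cong (All.map (occurrences-other s) a≢xs))
weight-∷ {a = a} {s} {x ∷ xs} (x≢xs ∷ u) (there a∈xs) =
  trans (cong₂ _+_ (occurrences-other s (All.lookup x≢xs a∈xs ∘ sym)) (weight-∷ u a∈xs)) (+-suc _ _)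

weight-allFin : ∀ (s : List (Fin n)) → weight (occurrences s) (allFin n) ≡ length s
weight-allFin {n = n} [] = weight-[] (allFin n)
weight-allFin {n = n} (a ∷ s) = trans (weight-∷ (allFin⁺ n) (∈-allFin a)) (cong suc (weight-allFin s))

-- `parking-rotation` moves the starting point of the circle; the inverse turn brings the circle
-- back to its standard order and turns the word instead.
parking-turn : ∀ {m} (s : List (Fin (suc m))) → length s ≡ m →
  ∃ λ d → Parking (occurrences (map (turn d) s)) (allFin (suc m))
parking-turn {m} s len with parking-rotation (occurrences s) (allFin (suc m))
  (cong suc (trans (weight-allFin s) (trans len (sym (length-tabulate suc)))))
... | U , V , eq , p with turn-++ 0 U (trans (map-id _) eq) | turn-inverse (length U + 0)
... | turned | e , inv = e , subst (Parking (occurrences (map (turn e) s))) back (Parking-map (turn-injective e) s p)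
  where
  open ≡-Reasoning
  back : map (turn e) (V ++ U) ≡ allFin (suc m)
  back = begin
    map (turn e) (V ++ U)                                           ≡⟨ cong (map (turn e)) turned ⟨
    map (turn e) (map (turn (length U + 0)) (allFin (suc m)))       ≡⟨ map-∘ _ ⟨
    map (turn e ∘ turn (length U + 0)) (allFin (suc m))             ≡⟨ map-cong inv _ ⟩
    map id (allFin (suc m))                                         ≡⟨ map-id _ ⟩
    allFin (suc m)                                                  ∎

-- The start position, and the count by rotation classes of words.

labels-start : ∀ n → labelsOf (start n) ≡ [ allFin n ]
labels-start n = cong [_] (trans (sym (map-∘ (allFin n))) (map-id (allFin n)))

Config-start : ∀ m → Config longCycle (labelsOf (start (suc m)))
Config-start m = subst (Config longCycle) (sym (labels-start (suc m))) (Config-longCycle m)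

Arms-start : ∀ n → Arms orig (start n)
Arms-start n = All.map⁺ (All.tabulate (λ _ → refl)) ∷ []

funToFin-cong : ∀ {k} {f g : Fin k → Fin n} → f ≗ g → funToFin f ≡ funToFin g
funToFin-cong {k = zero} eq = refl
funToFin-cong {k = suc k} eq = cong₂ combine (eq zero) (funToFin-cong (eq ∘ suc))

tabulate-injective : ∀ {k} {f g : Fin k → A} → tabulate f ≡ tabulate g → f ≗ g
tabulate-injective eq zero = ∷-injectiveˡ eq
tabulate-injective eq (suc i) = tabulate-injective (∷-injectiveʳ eq) i

list-as-code : ∀ {k} (xs : List (Fin n)) → length xs ≡ k → ∃ λ (c : Fin (n ^ k)) → tabulate (finToFun {n} {k} c) ≡ xs
list-as-code {n = n} xs refl = funToFin {n = n} (lookup xs) ,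
  trans (tabulate-cong (finToFun-funToFin (lookup xs))) (tabulate-lookup xs)

module _ (k : ℕ) where
  private
    m = suc k
    X : LabelPosition (suc m)
    X = [ allFin (suc m) ]

  Encodes⇒IsFactorization : ∀ {ts s} → Encodes X ts s → IsFactorization (suc m) ts
  Encodes⇒IsFactorization e =
    let len , trs , eq = Encodes⇒factorization e (Config-longCycle m) in record
    { length≡n∸1 = suc-injective (trans (+-comm 1 _) len) ; transposition = trs ; product≗cycle = eq }

  IsFactorization⇒Encodes : ∀ {ts} → IsFactorization (suc m) ts → ∃ λ s → Encodes X ts s
  IsFactorization⇒Encodes {ts} F = factorization⇒Encodes ts (Config-longCycle m) (IsFactorization.transposition F)
    (trans (+-comm _ 1) (cong suc (IsFactorization.length≡n∸1 F))) (IsFactorization.product≗cycle F)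

  -- Every rotation class of words of `m` letters has exactly one member beginning with `zero`,
  -- which leaves `k` letters free.
  code-word : Fin (suc m ^ k) → List (Fin (suc m))
  code-word c = zero ∷ tabulate (finToFun {suc m} {k} c)

  abstract
    code-turn : ∀ c → ∃ λ d → Parking (occurrences (map (turn d) (code-word c))) (allFin (suc m))
    code-turn c = parking-turn (code-word c) (cong suc (length-tabulate (finToFun {suc m} {k} c)))

    decode : ∀ c → ∃ λ ts → Encodes X ts (map (turn (proj₁ (code-turn c))) (code-word c))
    decode c = Parking⇒Encodes _ (Config-longCycle m) (proj₂ (code-turn c) ∷ [])

  -- The recorded words agree, and their first letters are the images of `zero` under the two turns.
  -- So the turns coincide and can be cancelled from the remaining letters.
  decode-injective : ∀ {c c′} → proj₁ (decode c) ≋ proj₁ (decode c′) → c ≡ c′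
  decode-injective {c} {c′} eq = begin
    c                     ≡⟨ funToFin-finToFin {k} {suc m} c ⟨
    funToFin (finToFun {suc m} {k} c)
      ≡⟨ funToFin-cong (tabulate-injective (map-injective (turn-injective d) same-tail)) ⟩
    funToFin (finToFun {suc m} {k} c′) ≡⟨ funToFin-finToFin {k} {suc m} c′ ⟩
    c′                    ∎
    where
    open ≡-Reasoning
    d  = proj₁ (code-turn c)
    d′ = proj₁ (code-turn c′)
    same : map (turn d) (code-word c) ≡ map (turn d′) (code-word c′)
    same = Encodes-injective (proj₂ (decode c)) (proj₂ (decode c′)) ↭-refl (Config-longCycle m) eq
    same-tail : map (turn d) (tabulate (finToFun {suc m} {k} c)) ≡ map (turn d) (tabulate (finToFun {suc m} {k} c′))
    same-tail = trans (∷-injectiveʳ same)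
      (map-cong (λ i → sym (turn-agree d d′ (∷-injectiveˡ same) i)) _)

  -- Turning the recorded word until it begins with `zero` gives the code. Decoding turns it further
  -- to a parking word, and since the original word was parking already, the combined turn is
  -- trivial.
  decode-surjective : ∀ {ts} → IsFactorization (suc m) ts → ∃ λ c → proj₁ (decode c) ≋ ts
  decode-surjective {ts} F with IsFactorization⇒Encodes F
  ... | s , e with trans (sym (Encodes⇒length e)) (IsFactorization.length≡n∸1 F)
  decode-surjective {ts} F | a ∷ s , e | len with turn-to-zero a
  ... | j , to-zero with list-as-code (map (turn j) s) (trans (length-map (turn j) s) (suc-injective len))
  ... | c , tab = c , Encodes-functional
    (subst (Encodes X _) turned-back (proj₂ (decode c))) e ↭-refl (Config-longCycle m)
    where
    d = proj₁ (code-turn c)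
    turned : map (turn d) (code-word c) ≡ map (turn (j + d)) (a ∷ s)
    turned = begin
      map (turn d) (code-word c)          ≡⟨ cong (map (turn d)) (cong₂ _∷_ (sym to-zero) tab) ⟩
      map (turn d) (map (turn j) (a ∷ s)) ≡⟨ map-∘ (a ∷ s) ⟨
      map (turn d ∘ turn j) (a ∷ s)       ≡⟨ map-cong (turn-+ j d) (a ∷ s) ⟨
      map (turn (j + d)) (a ∷ s)          ∎
      where open ≡-Reasoning
    turned-back : map (turn d) (code-word c) ≡ a ∷ s
    turned-back = trans turned (trans
      (map-cong (parking-turn-unique (j + d) (a ∷ s) (All.head (Encodes⇒Parking e (Config-longCycle m)))
        (subst (λ s → Parking (occurrences s) (allFin (suc m))) turned (proj₂ (code-turn c)))) (a ∷ s))
      (map-id (a ∷ s)))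

  factorization-bijection : Bijection (setoid (Fin (suc m ^ k))) (factorizationSetoid (suc m))
  factorization-bijection = record
    { to = to
    ; cong = λ { {c} refl → Setoid.refl (factorizationSetoid (suc m)) {to c} }
    ; bijective = decode-injective , λ (_ , F) →
        let c , eq = decode-surjective F in c , λ { refl → eq }
    }
    where
    to : Fin (suc m ^ k) → Σ (List (Permutation′ (suc m))) (IsFactorization (suc m))
    to c = proj₁ (decode c) , Encodes⇒IsFactorization (proj₂ (decode c))

theorem5 : ∀ (n : ℕ) → 2 ≤ n →
    (∀ (p : LineOfPlay n) → IsFactorization n (transpositions p))
    × (∀ (p q : LineOfPlay n) → SameLine p q ⇔ (transpositions p ≋ transpositions q))
    × (∀ (ts : List (Permutation′ n)) → IsFactorization n ts → ∃[ p ] (transpositions {P = start n} p ≋ ts))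
    × Bijection (setoid (Fin (n ^ (n ∸ 2)))) (factorizationSetoid n)
theorem5 n@(suc m@(suc k)) (s≤s (s≤s _)) =
  (λ p → let len , trs , eq = play-factorization p (Config-start m) in record
    { length≡n∸1 = suc-injective (trans (+-comm 1 _) len) ; transposition = trs ; product≗cycle = eq }) ,
  (λ p q → mk⇔
    (joins⇒transpositions orig p q longCycle-injective
      (Config-start m) (Config-start m) (Arms-start n) (Arms-start n))
    (transpositions⇒joins orig p q longCycle-injective
      (Config-start m) (Config-start m) (Arms-start n) (Arms-start n))) ,
  (λ ts F → let open IsFactorization F in
    factorization-play ts (Config-start m) (trans (+-comm _ 1) (cong suc length≡n∸1)) transposition product≗cycle) ,
  factorization-bijection k
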